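{- Let $q\ge 2$ and $d\ge1$ be integers. On the infinite $(q+1)$-regular tree $\mathbb{T}_{q+1}$, let $X,Y$ be vertices with $\operatorname{dist}(X,Y)=d$ and let $\sigma_X^n,\sigma_Y^n$ be the uniform probability measures on the spheres of radius $n$ centered at $X$ and $Y$. Put $\delta=\lfloor d/2\rfloor$, $\delta'=\lceil d/2\rceil$. Then, as $n\to\infty$, \[ W_1(\sigma_X^n, \sigma_Y^n) = A^{\mathrm{sphere}}_{d, q} \cdot n + B^{\mathrm{sphere}}_{d, q} + o(1), \] where \[ A^{\mathrm{sphere}}_{d,q} = \frac{2(q+1-q^{1-\delta'} - q^{ -\delta})}{q+1},\qquad B^{\mathrm{sphere}}_{d,q} = d + \frac{ -4q+2(\delta'(q-1)+1)q^{1-\delta'} + 2(\delta(q-1)+q) q^{ -\delta}}{q^2-1}. \]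
   Context: The sphere of radius $r$ centered at $u$ is $\{v:\operatorname{dist}(u,v)=r\}$ (it has $(q+1)q^{r-1}$ vertices for $r\ge1$ and $1$ vertex for $r=0$); $\sigma_u^r$ assigns equal mass to each of its vertices and $0$ elsewhere. $W_1$ is the $1$-Wasserstein distance with respect to graph distance: the minimum over couplings $\pi$ of $\mu,\nu$ of $\sum_{v,w}\operatorname{dist}(v,w)\pi(v,w)$.
   Formalization: The couplings π over which W₁ is minimized take rational values only, and the o(1) is expressed with rational ε; since the transport problem has rational data, the minimum over real couplings is the same. -}

module Defs where

open import Data.Nat as ℕ using (ℕ; zero; suc; _+_; _*_; _∸_; _^_; ⌊_/2⌋; ⌈_/2⌉)
open import Data.Fin using (Fin; _≟_)
open import Data.Integer as ℤ using (ℤ; +_)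
open import Data.Rational as ℚ using (ℚ; _/_)
open import Data.List using (List; []; _∷_; length; map; concatMap; allFin; upTo; filterᵇ)
open import Data.List.Membership.Propositional using (_∈_)
open import Data.Product using (Σ; _×_; ∃)
open import Data.Bool using (Bool; true; false)
open import Relation.Nullary using (does)
open import Relation.Binary.PropositionalEquality using (_≡_)

-- Vertices of the infinite (q+1)-regular tree T_{q+1}, rooted at 'root':
-- a non-root vertex at depth k+1 is described by its first step from the
-- root (one of q+1 neighbours) followed by k further steps away from the
-- root (one of q children each).  The root has q+1 neighbours, every other
-- vertex has its parent plus q children, i.e. degree q+1.
data Vertex (q : ℕ) : Set where
  root : Vertex q
  node : Fin (suc q) → List (Fin q) → Vertex q

depth : ∀ {q} → Vertex q → ℕ
depth root = 0
depth (node i p) = suc (length p)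

lcpList : ∀ {q} → List (Fin q) → List (Fin q) → ℕ
lcpList [] _ = 0
lcpList (_ ∷ _) [] = 0
lcpList (a ∷ as) (b ∷ bs) with does (a ≟ b)
... | true = suc (lcpList as bs)
... | false = 0

meetDepth : ∀ {q} → Vertex q → Vertex q → ℕ
meetDepth root _ = 0
meetDepth (node _ _) root = 0
meetDepth (node i p) (node j p') with does (i ≟ j)
... | true = suc (lcpList p p')
... | false = 0

-- graph distance in the tree: the unique path goes through the meet
dist : ∀ {q} → Vertex q → Vertex q → ℕ
dist u v = depth u + depth v ∸ 2 * meetDepth u v

stepLists : (q k : ℕ) → List (List (Fin q))
stepLists q zero = [] ∷ []
stepLists q (suc k) = concatMap (λ a → map (a ∷_) (stepLists q k)) (allFin q)

level : (q k : ℕ) → List (Vertex q)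
level q zero = root ∷ []
level q (suc k) = concatMap (λ i → map (node i) (stepLists q k)) (allFin (suc q))

ballRoot : (q k : ℕ) → List (Vertex q)
ballRoot q k = concatMap (level q) (upTo (suc k))

-- the sphere {v : dist(u,v) = r}, as a duplicate-free list
-- (every such v has depth ≤ depth u + r)
sphere : ∀ {q} → Vertex q → ℕ → List (Vertex q)
sphere {q} u r = filterᵇ (λ v → does (dist u v ℕ.≟ r)) (ballRoot q (depth u + r))

Σ[_]_ : ∀ {A : Set} → List A → (A → ℚ) → ℚ
Σ[ [] ] f = ℚ.0ℚ
Σ[ x ∷ xs ] f = f x ℚ.+ Σ[ xs ] f

-- 1/m for a positive natural m (value 0 for m = 0, never used here)
inv : ℕ → ℚ
inv zero = ℚ.0ℚ
inv (suc m) = + 1 / suc m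

-- a finitely supported measure on a type: a (duplicate-free) support list
-- and a mass function (meaningful on the support)
record FinMeasure (A : Set) : Set where
  constructor mkMeasure
  field
    support : List A
    mass : A → ℚ
open FinMeasure public

σ : ∀ {q} → Vertex q → ℕ → FinMeasure (Vertex q)
σ u r = mkMeasure (sphere u r) (λ _ → inv (length (sphere u r)))

IsCoupling : ∀ {A : Set} → FinMeasure A → FinMeasure A → (A → A → ℚ) → Set
IsCoupling μ ν π =
  (∀ v w → ℚ.0ℚ ℚ.≤ π v w)
  × (∀ v → v ∈ support μ → Σ[ support ν ] (λ w → π v w) ≡ mass μ v)
  × (∀ w → w ∈ support ν → Σ[ support μ ] (λ v → π v w) ≡ mass ν w)

cost : ∀ {q} → FinMeasure (Vertex q) → FinMeasure (Vertex q)
       → (Vertex q → Vertex q → ℚ) → ℚ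
cost μ ν π = Σ[ support μ ] (λ v → Σ[ support ν ] (λ w → (+ dist v w / 1) ℚ.* π v w))

-- W₁(μ,ν) = min over couplings of the cost.  Since we have no reals we
-- express bounds on W₁:  W₁ ≤ c  iff some coupling has cost ≤ c, and
-- c ≤ W₁  iff every coupling has cost ≥ c.
W₁≤ : ∀ {q} → FinMeasure (Vertex q) → FinMeasure (Vertex q) → ℚ → Set
W₁≤ μ ν c = ∃ λ π → IsCoupling μ ν π × cost μ ν π ℚ.≤ c

≤W₁ : ∀ {q} → ℚ → FinMeasure (Vertex q) → FinMeasure (Vertex q) → Set
≤W₁ c μ ν = ∀ π → IsCoupling μ ν π → c ℚ.≤ cost μ ν π

ℕ→ℚ : ℕ → ℚ
ℕ→ℚ m = + m / 1

Asphere : ℕ → ℕ → ℚ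
Asphere d q =
  (ℕ→ℚ 2 ℚ.* (ℕ→ℚ (q + 1) ℚ.- ℕ→ℚ q ℚ.* inv (q ^ ⌈ d /2⌉) ℚ.- inv (q ^ ⌊ d /2⌋)))
  ℚ.* inv (q + 1)

Bsphere : ℕ → ℕ → ℚ
Bsphere d q =
  ℕ→ℚ d ℚ.+
  ( ℚ.- (ℕ→ℚ (4 * q))
    ℚ.+ ℕ→ℚ 2 ℚ.* ℕ→ℚ (⌈ d /2⌉ * (q ∸ 1) + 1) ℚ.* ℕ→ℚ q ℚ.* inv (q ^ ⌈ d /2⌉)
    ℚ.+ ℕ→ℚ 2 ℚ.* ℕ→ℚ (⌊ d /2⌋ * (q ∸ 1) + q) ℚ.* inv (q ^ ⌊ d /2⌋) )
  ℚ.* inv (q * q ∸ 1)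

{-# OPTIONS --safe #-}

-- Write b = dist Y v.  On the sphere of radius n around X, a Kantorovich potential depending
-- only on b (b - d on the side b > n, -n on the side b < n) is shown to be feasible by the
-- four-point condition of the tree, and it is tight for pairs that are either joined by a geodesic
-- through the midpoint of X and Y, or lie on the same side with one of them between the other and
-- the far centre.  Mass that can stay on its side is therefore coupled along the latter pairs,
-- uniformly over descendants; all remaining mass lies on X's side for σ X n and on Y's side for
-- σ Y n and may be coupled arbitrarily.  By complementary slackness the cost equals the integral
-- of the potential, which is computed from the number q^(n-j) of points of the sphere whose
-- geodesic from X follows the geodesic to Y for at least j steps.  The result is exactly A n + B as
-- soon as n > d.
module Submission where

open import Defs
open import Data.Bool using (if_then_else_; true; false; _∨_; T?)
open import Data.Bool.Properties using (∨-comm)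
open import Data.Fin as Fin using (Fin)
open import Data.List using (List; []; _∷_; _∷ʳ_; length; map; concatMap; allFin; filter; initLast; _∷ʳ′_)
open import Data.List.Properties using (length-++; length-map; length-tabulate; ∷ʳ-injective; ∷-injectiveˡ; ∷-injectiveʳ; filter-all)
open import Data.List.Membership.Propositional using (_∈_; find; lose)
open import Data.List.Membership.Propositional.Properties using (∈-map⁺; ∈-map⁻; ∈-concatMap⁺; ∈-concatMap⁻; ∈-allFin; ∈-filter⁺; ∈-filter⁻; ∈-upTo⁺)
open import Data.List.Membership.Propositional.Properties.WithK using (unique∧set⇒bag)
open import Data.List.Relation.Binary.BagAndSetEquality using (∼bag⇒↭)
open import Data.List.Relation.Binary.Permutation.Propositional.Properties using (↭-length)
import Data.List.Relation.Unary.All as All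
open import Data.List.Relation.Unary.AllPairs using ([]; _∷_)
open import Data.List.Relation.Unary.Any using (here; there)
open import Data.List.Relation.Unary.Unique.Propositional using (Unique)
import Data.List.Relation.Unary.Unique.Propositional.Properties as Unique
open import Data.Nat.Tactic.RingSolver using (solve-∀)
open import Data.Product using (∃; ∃₂; _×_; _,_; proj₁; proj₂)
open import Data.Sum using (_⊎_; inj₁; inj₂; [_,_]′; swap)
open import Function using (_∘_)
open import Function.Bundles using (mk⇔)
open import Relation.Binary.Definitions using (Tri; tri<; tri≈; tri>)
open import Relation.Binary.PropositionalEquality
open import Relation.Nullary using (¬_; Dec; yes; no; does; contradiction)
open import Relation.Nullary.Decidable using (_⊎-dec_; dec-true; dec-false)
open import Relation.Unary using (Decidable)

-- For `v` and `w` on the two spheres put D = dist v w, b = dist Y v, a = dist X w. The encoding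
-- fixes a root, but the argument is centred at `X` and `Y`. Depths and meets serve only to obtain
-- the four-point condition, the parity of distances, the step from one vertex towards another and
-- the enumeration of spheres; the rest is metric. The remaining mass may be coupled arbitrarily
-- because it sits at b > n and at a > n. Then a + b exceeds 2n, the four-point condition forces D +
-- d = a + b, and the potential pays exactly D for every such pair. The threshold n > d enters
-- through D + d < D + n: if one point lies between the other and the far centre, D + d is strictly
-- the smallest of the three sums, and so a + b = 2n. The two powers of q in the slope A, divided by
-- q + 1, are the proportions of the sphere with at least δ' and with more than δ shared edges. They
-- agree for odd d; for even d they differ by the points with b = n, which hang off the midpoint.

module Tree where

  open import Data.Nat using (ℕ; zero; suc; _+_; _*_; _∸_; _^_; _⊓_; _≤_; _<_; z≤n; s≤s; _≟_; _≤?_; _≡ᵇ_)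
  open import Data.Nat.Properties hiding (_≟_; _≤?_)

  private variable
    q : ℕ

  -- Certificates for linear arithmetic: l ≤ r is a sum of hypotheses and k the slack.
  linear : ∀ {l r L R} k → l ≤ r → L + r + k ≡ R + l → L ≤ R
  linear {l} {r} {L} {R} k l≤r eq = +-cancelʳ-≤ r L R (≤-trans (m≤m+n (L + r) k) (≤-trans (≤-reflexive eq) (+-monoʳ-≤ R l≤r)))

  -- Longest common prefixes of lists

  lcp-sym : ∀ (p r : List (Fin q)) → lcpList p r ≡ lcpList r p
  lcp-sym [] [] = refl
  lcp-sym [] (_ ∷ _) = refl
  lcp-sym (_ ∷ _) [] = refl
  lcp-sym (a ∷ p) (b ∷ r) with a Fin.≟ b | b Fin.≟ a
  ... | yes _    | yes _    = cong suc (lcp-sym p r)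
  ... | no _     | no _     = refl
  ... | yes refl | no b≢a   = contradiction refl b≢a
  ... | no a≢b   | yes refl = contradiction refl a≢b

  lcp≤length : ∀ (p r : List (Fin q)) → lcpList p r ≤ length p
  lcp≤length [] r = z≤n
  lcp≤length (_ ∷ _) [] = z≤n
  lcp≤length (a ∷ p) (b ∷ r) with a Fin.≟ b
  ... | yes _ = s≤s (lcp≤length p r)
  ... | no _  = z≤n

  lcp-refl : ∀ (p : List (Fin q)) → lcpList p p ≡ length p
  lcp-refl [] = refl
  lcp-refl (a ∷ p) with a Fin.≟ a
  ... | yes _  = cong suc (lcp-refl p)
  ... | no a≢a = contradiction refl a≢a

  lcp-full : ∀ (p r : List (Fin q)) → lcpList p r ≡ length p → lcpList p r ≡ length r → p ≡ r
  lcp-full [] [] _ _ = refl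
  lcp-full [] (_ ∷ _) _ ()
  lcp-full (_ ∷ _) [] () _
  lcp-full (a ∷ p) (b ∷ r) e₁ e₂ with a Fin.≟ b
  lcp-full (a ∷ p) (b ∷ r) e₁ e₂ | yes refl = cong (a ∷_) (lcp-full p r (suc-injective e₁) (suc-injective e₂))
  lcp-full (a ∷ p) (b ∷ r) () e₂ | no _

  lcp-ultrametric : ∀ (p r s : List (Fin q)) → lcpList p r ⊓ lcpList r s ≤ lcpList p s
  lcp-ultrametric [] r s = z≤n
  lcp-ultrametric (a ∷ p) [] s = z≤n
  lcp-ultrametric (a ∷ p) (b ∷ r) [] = m⊓n≤n (lcpList (a ∷ p) (b ∷ r)) 0
  lcp-ultrametric (a ∷ p) (b ∷ r) (c ∷ s) with a Fin.≟ b | b Fin.≟ c | a Fin.≟ c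
  ... | yes _    | yes _    | yes _  = s≤s (lcp-ultrametric p r s)
  ... | yes refl | yes refl | no a≢a = contradiction refl a≢a
  ... | yes _    | no _     | _      = z≤n
  ... | no _     | _        | _      = z≤n

  lcp-snoc : ∀ (p r : List (Fin q)) a → lcpList p (r ∷ʳ a) ≡ lcpList p r
    ⊎ (lcpList p r ≡ length r × lcpList p (r ∷ʳ a) ≡ suc (length r))
  lcp-snoc [] r a = inj₁ refl
  lcp-snoc (x ∷ p) [] a with x Fin.≟ a
  ... | yes _ = inj₂ (refl , cong suc (trans (lcp-sym p []) refl))
  ... | no _  = inj₁ refl
  lcp-snoc (x ∷ p) (y ∷ r) a with x Fin.≟ y
  ... | no _ = inj₁ refl
  ... | yes _ with lcp-snoc p r a
  ...   | inj₁ e         = inj₁ (cong suc e)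
  ...   | inj₂ (e₁ , e₂) = inj₂ (cong suc e₁ , cong suc e₂)

  snoc-view : ∀ {A : Set} (x : A) xs → ∃₂ λ ys y → x ∷ xs ≡ ys ∷ʳ y
  snoc-view x xs with initLast xs
  ... | []       = [] , x , refl
  ... | ys ∷ʳ′ y = x ∷ ys , y , refl

  -- One step from `r` towards `p`: if `r` is a proper prefix of `p`, append the next letter of `p`;
  -- otherwise drop the last letter, which lies beyond the common prefix.
  lcp-closer : ∀ (p r : List (Fin q)) → p ≢ r →
    (∃₂ λ r′ a → r ≡ r′ ∷ʳ a × lcpList p r′ ≡ lcpList p r)
    ⊎ (∃ λ a → lcpList p r ≡ length r × lcpList p (r ∷ʳ a) ≡ suc (length r))
  lcp-closer [] [] p≢r = contradiction refl p≢r
  lcp-closer (x ∷ p) [] _ = inj₂ (x , refl , helper)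
    where
    helper : lcpList (x ∷ p) (x ∷ []) ≡ 1
    helper with x Fin.≟ x
    ... | yes _  = cong suc (lcp-sym p [])
    ... | no x≢x = contradiction refl x≢x
  lcp-closer [] (y ∷ r) _ with snoc-view y r
  ... | r′ , a , e = inj₁ (r′ , a , e , refl)
  lcp-closer (x ∷ p) (y ∷ r) p≢r with x Fin.≟ y
  lcp-closer (x ∷ p) (.x ∷ r) p≢r | yes refl with lcp-closer p r (λ e → p≢r (cong (x ∷_) e))
  ... | inj₁ (r′ , a , refl , e) = inj₁ (x ∷ r′ , a , refl , helper)
    where
    helper : lcpList (x ∷ p) (x ∷ r′) ≡ suc (lcpList p (r′ ∷ʳ a))
    helper with x Fin.≟ x
    ... | yes _  = cong suc e
    ... | no x≢x = contradiction refl x≢x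
  ... | inj₂ (a , e₁ , e₂) = inj₂ (a , cong suc e₁ , cong suc e₂)
  lcp-closer (x ∷ p) (y ∷ r) p≢r | no x≢y = inj₁ (differ r)
    where
    head≢ : ∀ t → lcpList (x ∷ p) (y ∷ t) ≡ 0
    head≢ t with x Fin.≟ y
    ... | yes x≡y = contradiction x≡y x≢y
    ... | no _    = refl
    differ : ∀ r → ∃₂ λ r′ a → y ∷ r ≡ r′ ∷ʳ a × lcpList (x ∷ p) r′ ≡ 0
    differ r with initLast r
    ... | []       = [] , y , refl , refl
    ... | r′ ∷ʳ′ a = y ∷ r′ , a , refl , head≢ r′

  -- Meets, distances and the four-point condition

  meet-sym : ∀ (u v : Vertex q) → meetDepth u v ≡ meetDepth v u
  meet-sym root root = refl
  meet-sym root (node _ _) = refl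
  meet-sym (node _ _) root = refl
  meet-sym (node i p) (node j r) with i Fin.≟ j | j Fin.≟ i
  ... | yes _    | yes _    = cong suc (lcp-sym p r)
  ... | no _     | no _     = refl
  ... | yes refl | no j≢i   = contradiction refl j≢i
  ... | no i≢j   | yes refl = contradiction refl i≢j

  meet≤depthˡ : ∀ (u v : Vertex q) → meetDepth u v ≤ depth u
  meet≤depthˡ root _ = z≤n
  meet≤depthˡ (node _ _) root = z≤n
  meet≤depthˡ (node i p) (node j r) with i Fin.≟ j
  ... | yes _ = s≤s (lcp≤length p r)
  ... | no _  = z≤n

  meet≤depthʳ : ∀ (u v : Vertex q) → meetDepth u v ≤ depth v
  meet≤depthʳ u v = subst (_≤ depth v) (meet-sym v u) (meet≤depthˡ v u)

  meet-refl : ∀ (u : Vertex q) → meetDepth u u ≡ depth u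
  meet-refl root = refl
  meet-refl (node i p) with i Fin.≟ i
  ... | yes _  = cong suc (lcp-refl p)
  ... | no i≢i = contradiction refl i≢i

  meet-full : ∀ (u v : Vertex q) → meetDepth u v ≡ depth u → meetDepth u v ≡ depth v → u ≡ v
  meet-full root root _ _ = refl
  meet-full root (node _ _) _ ()
  meet-full (node _ _) root () _
  meet-full (node i p) (node j r) e₁ e₂ with i Fin.≟ j
  meet-full (node i p) (node j r) e₁ e₂ | yes refl = cong (node i) (lcp-full p r (suc-injective e₁) (suc-injective e₂))
  meet-full (node i p) (node j r) () e₂ | no _

  meet-ultrametric : ∀ (u v w : Vertex q) → meetDepth u v ⊓ meetDepth v w ≤ meetDepth u w
  meet-ultrametric root v w = z≤n
  meet-ultrametric (node i p) root w = z≤n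
  meet-ultrametric (node i p) (node j r) root = m⊓n≤n (meetDepth (node i p) (node j r)) 0
  meet-ultrametric (node i p) (node j r) (node k s) with i Fin.≟ j | j Fin.≟ k | i Fin.≟ k
  ... | yes _    | yes _    | yes _  = s≤s (lcp-ultrametric p r s)
  ... | yes refl | yes refl | no i≢i = contradiction refl i≢i
  ... | yes _    | no _     | _      = z≤n
  ... | no _     | _        | _      = z≤n

  -- Frees `dist` of its truncated subtraction, so that distances can be handled by linear
  -- arithmetic.
  dist+2meet : ∀ (u v : Vertex q) → dist u v + 2 * meetDepth u v ≡ depth u + depth v
  dist+2meet u v = m∸n+n≡m {depth u + depth v} {2 * meetDepth u v} (linear 0 (+-mono-≤ (meet≤depthˡ u v) (meet≤depthʳ u v)) (lemma (meetDepth u v) (depth u + depth v)))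
    where
    lemma : ∀ m s → 2 * m + s + 0 ≡ s + (m + m)
    lemma = solve-∀

  dist-sym : ∀ (u v : Vertex q) → dist u v ≡ dist v u
  dist-sym u v = cong₂ _∸_ (+-comm (depth u) (depth v)) (cong (2 *_) (meet-sym u v))

  dist-refl : ∀ (u : Vertex q) → dist u u ≡ 0
  dist-refl u rewrite meet-refl u = trans (cong (depth u + depth u ∸_) (cong (depth u +_) (+-identityʳ (depth u)))) (n∸n≡0 (depth u + depth u))

  dist≡0⇒≡ : ∀ (u v : Vertex q) → dist u v ≡ 0 → u ≡ v
  dist≡0⇒≡ u v e = meet-full u v
    (≤-antisym (meet≤depthˡ u v) (linear 0 (+-mono-≤ (≤-reflexive (sym split)) (meet≤depthʳ u v)) (lemma₁ (depth u) (depth v) (meetDepth u v))))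
    (≤-antisym (meet≤depthʳ u v) (linear 0 (+-mono-≤ (≤-reflexive (sym split)) (meet≤depthˡ u v)) (lemma₂ (depth u) (depth v) (meetDepth u v))))
    where
    split : 2 * meetDepth u v ≡ depth u + depth v
    split = trans (cong (_+ 2 * meetDepth u v) (sym e)) (dist+2meet u v)
    lemma₁ : ∀ a b m → a + (2 * m + b) + 0 ≡ m + (a + b + m)
    lemma₁ = solve-∀
    lemma₂ : ∀ a b m → b + (2 * m + a) + 0 ≡ m + (a + b + m)
    lemma₂ = solve-∀

  ⊓≤-split : ∀ {m n o} → m ⊓ n ≤ o → m ≤ o ⊎ n ≤ o
  ⊓≤-split {m} {n} le with ≤-total m n
  ... | inj₁ m≤n = inj₁ (subst (_≤ _) (m≤n⇒m⊓n≡m m≤n) le)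
  ... | inj₂ n≤m = inj₂ (subst (_≤ _) (m≥n⇒m⊓n≡n n≤m) le)

  -- The ultrametric inequality is used for `x`, `y` through `z` and through `w`, and for `z`, `w`
  -- through `x` and through `y`. Most combinations of the outcomes add up directly; the two cyclic
  -- ones are settled by comparing `xw` with `yw`.
  meet-four-point : ∀ (x y z w : Vertex q) →
    meetDepth x z + meetDepth y w ≤ meetDepth x y + meetDepth z w
    ⊎ meetDepth x w + meetDepth y z ≤ meetDepth x y + meetDepth z w
  meet-four-point x y z w
    with ⊓≤-split (meet-ultrametric x z y) | ⊓≤-split (meet-ultrametric x w y)
       | ⊓≤-split (meet-ultrametric z x w) | ⊓≤-split (meet-ultrametric z y w)
  ... | c₁ | c₂ | c₃ | c₄ rewrite meet-sym z y | meet-sym z x | meet-sym w y = go c₁ c₂ c₃ c₄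
    where
    go : ∀ {xy zw xz yw xw yz} → xz ≤ xy ⊎ yz ≤ xy → xw ≤ xy ⊎ yw ≤ xy → xz ≤ zw ⊎ xw ≤ zw → yz ≤ zw ⊎ yw ≤ zw →
      xz + yw ≤ xy + zw ⊎ xw + yz ≤ xy + zw
    go {xy} {zw} {xz} {yw} {xw} {yz} = λ where
        (inj₁ a) _ _ (inj₂ d) → inj₁ (+-mono-≤ a d)
        (inj₂ a) _ (inj₂ c) _ → inj₂ (crosswise a c)
        _ (inj₁ b) _ (inj₁ d) → inj₂ (+-mono-≤ b d)
        _ (inj₂ b) (inj₁ c) _ → inj₁ (crosswise b c)
        (inj₁ a) (inj₂ b) (inj₂ c) (inj₁ d) → split (λ l → inj₂ (+-mono-≤ (≤-trans l b) d)) (λ l → inj₁ (+-mono-≤ a (≤-trans l c)))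
        (inj₂ a) (inj₁ b) (inj₁ c) (inj₂ d) → split (λ l → inj₂ (crosswise a (≤-trans l d))) (λ l → inj₁ (crosswise (≤-trans l b) c))
      where
      crosswise : ∀ {m n} → m ≤ xy → n ≤ zw → n + m ≤ xy + zw
      crosswise {m} {n} a b = subst (_≤ xy + zw) (+-comm m n) (+-mono-≤ a b)
      split : ∀ {C : Set} → (xw ≤ yw → C) → (yw ≤ xw → C) → C
      split f g = [ f , g ]′ (≤-total xw yw)

  -- Each of the three pairings contains every depth once, so depths cancel and inequalities between
  -- meets turn around. The arbitrary bound `s` stands for the maximum of the other two sums.
  four-point : ∀ (x y z w : Vertex q) {s} →
    dist x z + dist y w ≤ s → dist x w + dist y z ≤ s → dist x y + dist z w ≤ s
  four-point x y z w {s} h₁ h₂ with meet-four-point x y z w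
  ... | inj₁ le = linear 0
    (+-mono-≤ (+-mono-≤ h₁ (+-mono-≤ le le)) (≤-reflexive (cong₂ _+_ (cong₂ _+_ (dist+2meet x y) (dist+2meet z w)) (cong₂ _+_ (sym (dist+2meet x z)) (sym (dist+2meet y w))))))
    (lemma (dist x y) (dist z w) (dist x z) (dist y w) (meetDepth x y) (meetDepth z w) (meetDepth x z) (meetDepth y w) (depth x) (depth y) (depth z) (depth w) s)
    where
    lemma : ∀ xy zw xz yw mxy mzw mxz myw x y z w s →
      xy + zw + (s + ((mxy + mzw) + (mxy + mzw)) + ((x + y) + (z + w) + ((xz + 2 * mxz) + (yw + 2 * myw)))) + 0
      ≡ s + (xz + yw + ((mxz + myw) + (mxz + myw)) + ((xy + 2 * mxy) + (zw + 2 * mzw) + ((x + z) + (y + w))))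
    lemma = solve-∀
  ... | inj₂ le = linear 0
    (+-mono-≤ (+-mono-≤ h₂ (+-mono-≤ le le)) (≤-reflexive (cong₂ _+_ (cong₂ _+_ (dist+2meet x y) (dist+2meet z w)) (cong₂ _+_ (sym (dist+2meet x w)) (sym (dist+2meet y z))))))
    (lemma (dist x y) (dist z w) (dist x w) (dist y z) (meetDepth x y) (meetDepth z w) (meetDepth x w) (meetDepth y z) (depth x) (depth y) (depth z) (depth w) s)
    where
    lemma : ∀ xy zw xw yz mxy mzw mxw myz x y z w s →
      xy + zw + (s + ((mxy + mzw) + (mxy + mzw)) + ((x + y) + (z + w) + ((xw + 2 * mxw) + (yz + 2 * myz)))) + 0
      ≡ s + (xw + yz + ((mxw + myz) + (mxw + myz)) + ((xy + 2 * mxy) + (zw + 2 * mzw) + ((x + w) + (y + z))))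
    lemma = solve-∀

  -- The four-point condition with its last two points both equal to `y`.
  triangle : ∀ (x y z : Vertex q) → dist x z ≤ dist x y + dist y z
  triangle x y z = subst (_≤ dist x y + dist y z) (trans (cong (dist x z +_) (dist-refl y)) (+-identityʳ _))
    (four-point x z y y le le)
    where
    le : dist x y + dist z y ≤ dist x y + dist y z
    le = ≤-reflexive (cong (dist x y +_) (dist-sym z y))

  -- Parents, children and neighbours

  data Child {q} : Vertex q → Vertex q → Set where
    first : ∀ {i} → Child root (node i [])
    next  : ∀ {i r a} → Child (node i r) (node i (r ∷ʳ a))

  depth-child : ∀ {v c : Vertex q} → Child v c → depth c ≡ suc (depth v)
  depth-child first = refl
  depth-child (next {r = r}) = cong suc (trans (length-++ r) (+-comm (length r) 1))

  meet-child : ∀ {v c : Vertex q} → Child v c → ∀ y →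
    meetDepth y c ≡ meetDepth y v ⊎ (meetDepth y v ≡ depth v × meetDepth y c ≡ suc (depth v))
  meet-child first root = inj₁ refl
  meet-child (first {i}) (node j p) with j Fin.≟ i
  ... | yes _ = inj₂ (refl , cong suc (lcp-sym p []))
  ... | no _  = inj₁ refl
  meet-child next root = inj₁ refl
  meet-child (next {i} {r} {a}) (node j p) with j Fin.≟ i
  ... | no _  = inj₁ refl
  ... | yes _ with lcp-snoc p r a
  ...   | inj₁ e         = inj₁ (cong suc e)
  ...   | inj₂ (e₁ , e₂) = inj₂ (cong suc e₁ , cong suc e₂)

  dist-away : ∀ {v c : Vertex q} → Child v c → ∀ y → meetDepth y c ≡ meetDepth y v → dist y c ≡ suc (dist y v)
  dist-away {v = v} {c} ch y e = +-cancelʳ-≡ (2 * meetDepth y c) _ _ (begin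
    dist y c + 2 * meetDepth y c          ≡⟨ dist+2meet y c ⟩
    depth y + depth c                     ≡⟨ cong (depth y +_) (depth-child ch) ⟩
    depth y + suc (depth v)               ≡⟨ +-suc (depth y) (depth v) ⟩
    suc (depth y + depth v)               ≡⟨ cong suc (dist+2meet y v) ⟨
    suc (dist y v) + 2 * meetDepth y v    ≡⟨ cong (λ m → suc (dist y v) + 2 * m) e ⟨
    suc (dist y v) + 2 * meetDepth y c    ∎)
    where open ≡-Reasoning

  dist-towards : ∀ {v c : Vertex q} → Child v c → ∀ y →
    meetDepth y v ≡ depth v → meetDepth y c ≡ suc (depth v) → dist y v ≡ suc (dist y c)
  dist-towards {v = v} {c} ch y e₁ e₂ = +-cancelʳ-≡ (1 + 2 * meetDepth y v) _ _ (begin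
    dist y v + (1 + 2 * meetDepth y v)    ≡⟨ +-suc (dist y v) _ ⟩
    suc (dist y v + 2 * meetDepth y v)    ≡⟨ cong suc (dist+2meet y v) ⟩
    suc (depth y + depth v)               ≡⟨ +-suc (depth y) (depth v) ⟨
    depth y + suc (depth v)               ≡⟨ cong (depth y +_) (depth-child ch) ⟨
    depth y + depth c                     ≡⟨ dist+2meet y c ⟨
    dist y c + 2 * meetDepth y c          ≡⟨ cong (λ m → dist y c + 2 * m) (trans e₂ (cong suc (sym e₁))) ⟩
    dist y c + 2 * suc (meetDepth y v)    ≡⟨ lemma (dist y c) (meetDepth y v) ⟩
    suc (dist y c) + (1 + 2 * meetDepth y v) ∎)
    where
    open ≡-Reasoning
    lemma : ∀ c m → c + 2 * suc m ≡ suc c + (1 + 2 * m)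
    lemma = solve-∀

  dist-child : ∀ {v c : Vertex q} → Child v c → ∀ y → dist y c ≡ suc (dist y v) ⊎ dist y v ≡ suc (dist y c)
  dist-child ch y with meet-child ch y
  ... | inj₁ e         = inj₁ (dist-away ch y e)
  ... | inj₂ (e₁ , e₂) = inj₂ (dist-towards ch y e₁ e₂)

  meet-node : ∀ i (p r : List (Fin q)) → meetDepth (node i p) (node i r) ≡ suc (lcpList p r)
  meet-node i p r with i Fin.≟ i
  ... | yes _  = refl
  ... | no i≢i = contradiction refl i≢i

  meet-node≢ : ∀ {i j} → i ≢ j → ∀ (p r : List (Fin q)) → meetDepth (node i p) (node j r) ≡ 0
  meet-node≢ {i = i} {j} i≢j p r with i Fin.≟ j
  ... | yes i≡j = contradiction i≡j i≢j
  ... | no _    = refl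

  parentOf : Fin (suc q) → List (Fin q) → Vertex q
  parentOf i []      = root
  parentOf i (x ∷ r) = node i (proj₁ (snoc-view x r))

  parentOf-child : ∀ i (r : List (Fin q)) → Child (parentOf i r) (node i r)
  parentOf-child i []      = first
  parentOf-child i (x ∷ r) with snoc-view x r
  ... | r′ , a , e = subst (λ t → Child (node i r′) (node i t)) (sym e) next

  closer-meet : ∀ (y v : Vertex q) → y ≢ v →
    (∃ λ u → Child u v × meetDepth y v ≡ meetDepth y u)
    ⊎ (∃ λ c → Child v c × meetDepth y v ≡ depth v × meetDepth y c ≡ suc (depth v))
  closer-meet root root y≢v = contradiction refl y≢v
  closer-meet root (node i r) _ = inj₁ (parentOf i r , parentOf-child i r , refl)
  closer-meet (node j p) root _ = inj₂ (node j [] , first , refl , trans (meet-node j p []) (cong suc (lcp-sym p [])))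
  closer-meet (node j p) (node i r) y≢v = go (j Fin.≟ i)
    where
    far : j ≢ i → ∀ r → meetDepth (node j p) (parentOf i r) ≡ 0
    far j≢i []      = refl
    far j≢i (x ∷ r) = meet-node≢ j≢i p _
    go : Dec (j ≡ i) → _
    go (no j≢i) = inj₁ (parentOf i r , parentOf-child i r , trans (meet-node≢ j≢i p r) (sym (far j≢i r)))
    go (yes refl) with lcp-closer p r (y≢v ∘ cong (node i))
    ... | inj₁ (r′ , a , refl , e) = inj₁ (node i r′ , next , trans (meet-node i p r) (trans (cong suc (sym e)) (sym (meet-node i p r′))))
    ... | inj₂ (a , e₁ , e₂) = inj₂ (node i (r ∷ʳ a) , next , trans (meet-node i p r) (cong suc e₁) , trans (meet-node i p (r ∷ʳ a)) (cong suc e₂))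

  children : Vertex q → List (Vertex q)
  children {q} root       = map (λ i → node i []) (allFin (suc q))
  children {q} (node i r) = map (λ a → node i (r ∷ʳ a)) (allFin q)

  neighbours : Vertex q → List (Vertex q)
  neighbours root       = children root
  neighbours (node i r) = parentOf i r ∷ children (node i r)

  ∈-children⁺ : ∀ {v c : Vertex q} → Child v c → c ∈ children v
  ∈-children⁺ first = ∈-map⁺ _ (∈-allFin _)
  ∈-children⁺ next  = ∈-map⁺ _ (∈-allFin _)

  ∈-children⁻ : ∀ {v c : Vertex q} → c ∈ children v → Child v c
  ∈-children⁻ {v = root} c∈ with ∈-map⁻ _ c∈
  ... | _ , _ , refl = first
  ∈-children⁻ {v = node _ _} c∈ with ∈-map⁻ _ c∈
  ... | _ , _ , refl = next

  node-injective : ∀ {i j} {p r : List (Fin q)} → node i p ≡ node j r → i ≡ j × p ≡ r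
  node-injective refl = refl , refl

  parent-unique : ∀ {u u′ v v′ : Vertex q} → Child u v → Child u′ v′ → v ≡ v′ → u ≡ u′
  parent-unique first first _ = refl
  parent-unique first (next {r = []}) ()
  parent-unique first (next {r = _ ∷ _}) ()
  parent-unique (next {r = []}) first ()
  parent-unique (next {r = _ ∷ _}) first ()
  parent-unique (next {r = r}) (next {r = r′}) e with node-injective e
  ... | refl , e′ = cong (node _) (proj₁ (∷ʳ-injective r r′ e′))

  neighbour-dist : ∀ {u v : Vertex q} → u ∈ neighbours v → ∀ y → dist y u ≡ suc (dist y v) ⊎ dist y v ≡ suc (dist y u)
  neighbour-dist {v = root} u∈ y = dist-child (∈-children⁻ u∈) y
  neighbour-dist {v = node i r} (here refl) y = swap (dist-child (parentOf-child i r) y)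
  neighbour-dist {v = node i r} (there u∈) y = dist-child (∈-children⁻ {v = node i r} u∈) y

  closer-neighbour : ∀ (y v : Vertex q) → y ≢ v → ∃ λ u → u ∈ neighbours v × dist y v ≡ suc (dist y u)
  closer-neighbour y v y≢v with closer-meet y v y≢v
  ... | inj₁ (u , ch , e) = u , parent∈ ch , dist-away ch y e
    where
    parent∈ : ∀ {v} → Child u v → u ∈ neighbours v
    parent∈ {node i r} ch = here (parent-unique ch (parentOf-child i r) refl)
  ... | inj₂ (c , ch , e₁ , e₂) = c , child∈ v (∈-children⁺ ch) , dist-towards ch y e₁ e₂
    where
    child∈ : ∀ v → c ∈ children v → c ∈ neighbours v
    child∈ root       c∈ = c∈
    child∈ (node _ _) c∈ = there c∈

  neighbours-length : ∀ (v : Vertex q) → length (neighbours v) ≡ suc q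
  neighbours-length {q} root       = trans (length-map _ (allFin (suc q))) (length-tabulate (λ i → i))
  neighbours-length {q} (node i r) = cong suc (trans (length-map _ (allFin q)) (length-tabulate (λ i → i)))

  neighbours-unique : ∀ (v : Vertex q) → Unique (neighbours v)
  neighbours-unique {q} root = Unique.map⁺ (proj₁ ∘ node-injective) (Unique.allFin⁺ (suc q))
  neighbours-unique {q} (node i r) = All.tabulate parent∉ ∷ Unique.map⁺ (proj₂ ∘ ∷ʳ-injective r r ∘ proj₂ ∘ node-injective) (Unique.allFin⁺ q)
    where
    parent∉ : ∀ {c} → c ∈ children (node i r) → parentOf i r ≢ c
    parent∉ c∈ refl = <-irrefl (trans (depth-child (parentOf-child i r)) (cong suc (depth-child (∈-children⁻ {v = node i r} c∈)))) (m≤n⇒m≤1+n ≤-refl)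

  -- i is the Gromov product of v and y seen from x.
  dist-parity : ∀ (x y v : Vertex q) → ∃ λ i → dist y v + 2 * i ≡ dist x v + dist x y
  dist-parity x y v = arith {dist y v} {dist x v} {dist x y} (depth x) (depth y) (depth v) (meetDepth x v) (meetDepth x y) (meetDepth y v)
    (dist+2meet y v) (dist+2meet x v) (dist+2meet x y)
    (subst (dist y v ≤_) (trans (+-comm (dist y x) (dist x v)) (cong (dist x v +_) (dist-sym y x))) (triangle y x v))
    where
    arith : ∀ {b n D} X Y v xv xy yv → b + 2 * yv ≡ Y + v → n + 2 * xv ≡ X + v → D + 2 * xy ≡ X + Y → b ≤ n + D →
      ∃ λ i → b + 2 * i ≡ n + D
    arith {b} {n} {D} X Y v xv xy yv e₁ e₂ e₃ b≤n+D = i , +-cancelˡ-≡ (2 * (xv + xy)) _ _ (begin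
      2 * (xv + xy) + (b + 2 * i)  ≡⟨ lemma₁ (xv + xy) b i ⟩
      2 * (i + (xv + xy)) + b      ≡⟨ cong (λ t → 2 * t + b) (m∸n+n≡m M≤P) ⟩
      2 * (X + yv) + b             ≡⟨ total ⟨
      2 * (xv + xy) + (n + D)      ∎)
      where
      open ≡-Reasoning
      -- The depths of `v` and `y` cancel from the Gromov product, leaving this combination of one
      -- depth and three meets; `M≤P`, a form of the triangle inequality, shows that nothing is
      -- truncated.
      i : ℕ
      i = (X + yv) ∸ (xv + xy)
      lemma₁ : ∀ m b i → 2 * m + (b + 2 * i) ≡ 2 * (i + m) + b
      lemma₁ = solve-∀
      lemma₂ : ∀ n D xv xy → 2 * (xv + xy) + (n + D) ≡ (n + 2 * xv) + (D + 2 * xy)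
      lemma₂ = solve-∀
      lemma₃ : ∀ X Y v → (X + v) + (X + Y) ≡ 2 * X + (Y + v)
      lemma₃ = solve-∀
      lemma₄ : ∀ X b yv → 2 * X + (b + 2 * yv) ≡ 2 * (X + yv) + b
      lemma₄ = solve-∀
      total : 2 * (xv + xy) + (n + D) ≡ 2 * (X + yv) + b
      total = begin
        2 * (xv + xy) + (n + D)            ≡⟨ lemma₂ n D xv xy ⟩
        (n + 2 * xv) + (D + 2 * xy)        ≡⟨ cong₂ _+_ e₂ e₃ ⟩
        (X + v) + (X + Y)                  ≡⟨ lemma₃ X Y v ⟩
        2 * X + (Y + v)                    ≡⟨ cong (2 * X +_) e₁ ⟨
        2 * X + (b + 2 * yv)               ≡⟨ lemma₄ X b yv ⟩
        2 * (X + yv) + b                   ∎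
      M≤P : xv + xy ≤ X + yv
      M≤P = *-cancelˡ-≤ 2 (linear 0 b≤n+D (trans (+-identityʳ _) total))

  -- Enumeration of levels, balls and spheres

  module _ {A B : Set} where

    ∈-concatMap⁻′ : ∀ {f : A → List B} xs {y} → y ∈ concatMap f xs → ∃ λ x → x ∈ xs × y ∈ f x
    ∈-concatMap⁻′ {f} xs y∈ = find (∈-concatMap⁻ f {xs = xs} y∈)

    ∈-concatMap⁺′ : ∀ {f : A → List B} {xs x y} → x ∈ xs → y ∈ f x → y ∈ concatMap f xs
    ∈-concatMap⁺′ {f} x∈ y∈ = ∈-concatMap⁺ f (lose x∈ y∈)

    concatMap-unique : ∀ {f : A → List B} {xs} → Unique xs → (∀ {x} → x ∈ xs → Unique (f x)) →
      (∀ {x x′ y} → x ∈ xs → x′ ∈ xs → y ∈ f x → y ∈ f x′ → x ≡ x′) → Unique (concatMap f xs)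
    concatMap-unique {xs = []} [] _ _ = []
    concatMap-unique {f} {x ∷ xs} (x∉ ∷ xs!) fx! disjoint = Unique.++⁺ (fx! (here refl))
      (concatMap-unique xs! (fx! ∘ there) (λ x∈ x′∈ → disjoint (there x∈) (there x′∈)))
      λ (y∈fx , y∈rest) → let x′ , x′∈ , y∈fx′ = ∈-concatMap⁻′ xs y∈rest
                          in All.lookup x∉ x′∈ (disjoint (here refl) (there x′∈) y∈fx y∈fx′)

  ∈-stepLists⁺ : ∀ (p : List (Fin q)) → p ∈ stepLists q (length p)
  ∈-stepLists⁺ []      = here refl
  ∈-stepLists⁺ (a ∷ p) = ∈-concatMap⁺′ (∈-allFin a) (∈-map⁺ (a ∷_) (∈-stepLists⁺ p))

  ∈-stepLists⁻ : ∀ k {p : List (Fin q)} → p ∈ stepLists q k → length p ≡ k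
  ∈-stepLists⁻ zero (here refl) = refl
  ∈-stepLists⁻ {q} (suc k) p∈ with ∈-concatMap⁻′ (allFin q) p∈
  ... | a , _ , p∈′ with ∈-map⁻ (a ∷_) p∈′
  ...   | _ , r∈ , refl = cong suc (∈-stepLists⁻ k r∈)

  stepLists-unique : ∀ q k → Unique (stepLists q k)
  stepLists-unique q zero    = All.[] ∷ []
  stepLists-unique q (suc k) = concatMap-unique (Unique.allFin⁺ q)
    (λ _ → Unique.map⁺ ∷-injectiveʳ (stepLists-unique q k)) heads
    where
    heads : ∀ {a b : Fin q} {p} → a ∈ allFin q → b ∈ allFin q →
      p ∈ map (a ∷_) (stepLists q k) → p ∈ map (b ∷_) (stepLists q k) → a ≡ b
    heads {a} {b} _ _ p∈ p∈′ with ∈-map⁻ (a ∷_) p∈ | ∈-map⁻ (b ∷_) p∈′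
    ... | _ , _ , refl | _ , _ , e = ∷-injectiveˡ e

  ∈-level⁺ : ∀ (v : Vertex q) → v ∈ level q (depth v)
  ∈-level⁺ root       = here refl
  ∈-level⁺ (node i p) = ∈-concatMap⁺′ (∈-allFin i) (∈-map⁺ (node i) (∈-stepLists⁺ p))

  ∈-level⁻ : ∀ k {v : Vertex q} → v ∈ level q k → depth v ≡ k
  ∈-level⁻ zero (here refl) = refl
  ∈-level⁻ {q} (suc k) v∈ with ∈-concatMap⁻′ (allFin (suc q)) v∈
  ... | i , _ , v∈′ with ∈-map⁻ (node i) v∈′
  ...   | _ , p∈ , refl = cong suc (∈-stepLists⁻ k p∈)

  level-unique : ∀ q k → Unique (level q k)
  level-unique q zero    = All.[] ∷ []
  level-unique q (suc k) = concatMap-unique (Unique.allFin⁺ (suc q))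
    (λ _ → Unique.map⁺ (proj₂ ∘ node-injective) (stepLists-unique q k)) heads
    where
    heads : ∀ {i j : Fin (suc q)} {v} → i ∈ allFin (suc q) → j ∈ allFin (suc q) →
      v ∈ map (node i) (stepLists q k) → v ∈ map (node j) (stepLists q k) → i ≡ j
    heads {i} {j} _ _ v∈ v∈′ with ∈-map⁻ (node i) v∈ | ∈-map⁻ (node j) v∈′
    ... | _ , _ , refl | _ , _ , e = proj₁ (node-injective e)

  ballRoot-unique : ∀ q k → Unique (ballRoot q k)
  ballRoot-unique q k = concatMap-unique (Unique.upTo⁺ (suc k)) (λ {j} _ → level-unique q j)
    (λ {i} {j} _ _ v∈ v∈′ → trans (sym (∈-level⁻ i v∈)) (∈-level⁻ j v∈′))

  sphere-unique : ∀ (u : Vertex q) n → Unique (sphere u n)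
  sphere-unique {q} u n = Unique.filter⁺ (λ v → T? (dist u v ≡ᵇ n)) (ballRoot-unique q (depth u + n))

  ∈-sphere⁻ : ∀ (u : Vertex q) {v n} → v ∈ sphere u n → dist u v ≡ n
  ∈-sphere⁻ {q} u {v} {n} v∈ = ≡ᵇ⇒≡ (dist u v) n (proj₂ (∈-filter⁻ (λ v → T? (dist u v ≡ᵇ n)) {xs = ballRoot q (depth u + n)} v∈))

  ∈-sphere⁺ : ∀ (u v : Vertex q) {n} → dist u v ≡ n → v ∈ sphere u n
  ∈-sphere⁺ {q} u v {n} e = ∈-filter⁺ (λ v → T? (dist u v ≡ᵇ n))
    (∈-concatMap⁺′ {f = level q} (∈-upTo⁺ (s≤s depth≤)) (∈-level⁺ v)) (≡⇒≡ᵇ (dist u v) n e)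
    where
    lemma : ∀ du dv n m → dv + (n + 2 * m + (du + du)) + 0 ≡ du + n + (du + dv + (m + m))
    lemma = solve-∀
    depth≤ : depth v ≤ depth u + n
    depth≤ = linear 0 (+-mono-≤ (≤-reflexive (trans (sym (dist+2meet u v)) (cong (_+ 2 * meetDepth u v) e))) (+-mono-≤ (meet≤depthˡ u v) (meet≤depthˡ u v))) (lemma (depth u) (depth v) n (meetDepth u v))

  -- Points on geodesics

  between : ∀ r k (x y : Vertex q) → dist x y ≡ r + k → ∃ λ w → dist x w ≡ r × dist w y ≡ k
  between r zero x y e = y , trans e (+-identityʳ r) , dist-refl y
  between r (suc k) x y e with closer-neighbour x y (λ { refl → 0≢1+n (trans (sym (dist-refl x)) (trans e (+-suc r k))) })
  ... | u , u∈ , e′ with between r k x u (suc-injective (trans (sym e′) (trans e (+-suc r k))))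
  ...   | w , xw , wu with neighbour-dist u∈ w
  ...     | inj₂ wy = w , xw , trans wy (cong suc wu)
  -- If `y` were closer to `w` than `u` is, the route from `x` to `y` through `w` would be shorter
  -- than `dist x y`.
  ...     | inj₁ wu≡ = contradiction (triangle x w y) (<⇒≱ (≤-trans
              (≤-reflexive (cong (λ a → suc (a + dist w y)) xw))
              (subst (suc (r + dist w y) ≤_) (sym e) (linear 1 (≤-reflexive (trans (sym wu≡) wu)) (lemma r (dist w y) k)))))
    where
    lemma : ∀ r w k → suc (r + w) + k + 1 ≡ r + suc k + suc w
    lemma = solve-∀

  -- In the four-point condition for `w`, `w′` against `x`, `y`, the two other sums are both r + k =
  -- dist x y, which leaves 0 for `dist w w′`.
  between-unique : ∀ {r k} (x y w w′ : Vertex q) → dist x y ≡ r + k → dist x w ≡ r → dist w y ≡ k → dist x w′ ≡ r → dist w′ y ≡ k → w ≡ w′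
  between-unique {r = r} {k} x y w w′ xy xw wy xw′ w′y = dist≡0⇒≡ w w′ (n≤0⇒n≡0 (+-cancelʳ-≤ (r + k) (dist w w′) 0
    (subst (λ t → dist w w′ + t ≤ r + k) xy (four-point w w′ x y
      (≤-reflexive (cong₂ _+_ (trans (dist-sym w x) xw) w′y))
      (≤-reflexive (trans (cong₂ _+_ wy (trans (dist-sym w′ x) xw′)) (+-comm k r)))))))

  ∈-neighbours⁺ : ∀ (w u : Vertex q) → dist w u ≡ 1 → u ∈ neighbours w
  ∈-neighbours⁺ w u e with closer-neighbour u w (λ { refl → 0≢1+n (trans (sym (dist-refl w)) e) })
  ... | t , t∈ , e′ = subst (_∈ neighbours w) (sym (dist≡0⇒≡ u t (suc-injective (trans (sym e′) (trans (dist-sym u w) e))))) t∈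

  ∈-neighbours⁻ : ∀ (w : Vertex q) {u} → u ∈ neighbours w → dist w u ≡ 1
  ∈-neighbours⁻ w u∈ with neighbour-dist u∈ w
  ... | inj₁ e = trans e (cong suc (dist-refl w))
  ... | inj₂ e = contradiction (trans (sym (dist-refl w)) e) 0≢1+n

  unique-length : ∀ {A : Set} {xs ys : List A} → Unique xs → Unique ys →
    (∀ {z} → z ∈ xs → z ∈ ys) → (∀ {z} → z ∈ ys → z ∈ xs) → length xs ≡ length ys
  unique-length xs! ys! ⊆ ⊇ = ↭-length (∼bag⇒↭ (unique∧set⇒bag xs! ys! (mk⇔ ⊆ ⊇)))

  filter-all-but-one : ∀ {A : Set} {P : A → Set} (P? : Decidable P) {xs x₀} → Unique xs → x₀ ∈ xs → ¬ P x₀ →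
    (∀ {x} → x ∈ xs → ¬ P x → x ≡ x₀) → suc (length (filter P? xs)) ≡ length xs
  filter-all-but-one P? {x ∷ xs} (x∉ ∷ xs!) x₀∈ ¬Px₀ only with P? x
  filter-all-but-one P? {x ∷ xs} (x∉ ∷ xs!) (here refl) ¬Px₀ only | yes Px = contradiction Px ¬Px₀
  filter-all-but-one P? {x ∷ xs} (x∉ ∷ xs!) (there x₀∈) ¬Px₀ only | yes Px = cong suc (filter-all-but-one P? xs! x₀∈ ¬Px₀ (only ∘ there))
  filter-all-but-one P? {x ∷ xs} (x∉ ∷ xs!) x₀∈ ¬Px₀ only | no ¬Px = cong (suc ∘ length) (filter-all P? (All.tabulate rest))
    where
    rest : ∀ {y} → y ∈ xs → _
    rest {y} y∈ with P? y
    ... | yes Py = Py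
    ... | no ¬Py = contradiction (trans (only (here refl) ¬Px) (sym (only (there y∈) ¬Py))) (All.lookup x∉ y∈)

  -- Descendants seen from a centre, and sizes of spheres

  outward : Vertex q → Vertex q → List (Vertex q)
  outward y w = filter (λ u → dist y u ≟ suc (dist y w)) (neighbours w)

  ∈-outward⁻ : ∀ (y w : Vertex q) {u} → u ∈ outward y w → dist w u ≡ 1 × dist y u ≡ suc (dist y w)
  ∈-outward⁻ y w u∈ with ∈-filter⁻ (λ u → dist y u ≟ suc (dist y w)) {xs = neighbours w} u∈
  ... | u∈′ , e = ∈-neighbours⁻ w u∈′ , e

  ∈-outward⁺ : ∀ (y w u : Vertex q) → dist w u ≡ 1 → dist y u ≡ suc (dist y w) → u ∈ outward y w
  ∈-outward⁺ y w u e e′ = ∈-filter⁺ (λ u → dist y u ≟ suc (dist y w)) (∈-neighbours⁺ w u e) e′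

  -- Exactly one neighbour of `w` is nearer to `y`: by `between-unique`, two of them would be the
  -- same last stop on the geodesic from `y` to `w`.
  outward-length : ∀ (y w : Vertex q) → y ≢ w → length (outward y w) ≡ q
  outward-length {q} y w y≢w with closer-neighbour y w y≢w
  ... | u , u∈ , e = suc-injective (trans
    (filter-all-but-one (λ u → dist y u ≟ suc (dist y w)) (neighbours-unique w) u∈
      (λ e′ → m≢1+m+n (dist y u) (trans (trans e′ (cong suc e)) (cong suc (+-comm 1 (dist y u))))) only)
    (neighbours-length w))
    where
    only : ∀ {t} → t ∈ neighbours w → dist y t ≢ suc (dist y w) → t ≡ u
    only {t} t∈ far with neighbour-dist t∈ y
    ... | inj₁ e′ = contradiction e′ far
    ... | inj₂ e′ = between-unique y w t u (trans e (+-comm 1 _)) (suc-injective (trans (sym e′) e)) (trans (dist-sym t w) (∈-neighbours⁻ w t∈)) refl (trans (dist-sym u w) (∈-neighbours⁻ w u∈))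

  outward-length-self : ∀ (y : Vertex q) → length (outward y y) ≡ suc q
  outward-length-self y = trans (cong length (filter-all (λ u → dist y u ≟ suc (dist y y)) {xs = neighbours y}
    (All.tabulate λ u∈ → trans (∈-neighbours⁻ y u∈) (cong suc (sym (dist-refl y)))))) (neighbours-length y)

  -- The tree re-rooted at `y`: the m-th generation below `v`. This frees counting from the root of
  -- the encoding.
  descendants : Vertex q → Vertex q → ℕ → List (Vertex q)
  descendants y v zero    = v ∷ []
  descendants y v (suc m) = concatMap (outward y) (descendants y v m)

  ∈-descendants⁻ : ∀ (y v : Vertex q) m {w} → w ∈ descendants y v m → dist v w ≡ m × dist y w ≡ dist y v + m
  ∈-descendants⁻ y v zero (here refl) = dist-refl v , sym (+-identityʳ _)
  ∈-descendants⁻ y v (suc m) {u} u∈ with ∈-concatMap⁻′ (descendants y v m) u∈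
  ... | w , w∈ , u∈′ with ∈-descendants⁻ y v m w∈ | ∈-outward⁻ y w u∈′
  ...   | vw , yw | wu , yu = ≤-antisym (≤-trans (triangle v w u) (≤-reflexive (trans (cong₂ _+_ vw wu) (+-comm m 1)))) lower , yu′
    where
    yu′ : dist y u ≡ dist y v + suc m
    yu′ = trans yu (trans (cong suc yw) (sym (+-suc _ m)))
    lower : suc m ≤ dist v u
    lower = +-cancelˡ-≤ (dist y v) (suc m) (dist v u) (subst (_≤ dist y v + dist v u) yu′ (triangle y v u))

  ∈-descendants⁺ : ∀ (y v : Vertex q) m {w} → dist v w ≡ m → dist y w ≡ dist y v + m → w ∈ descendants y v m
  ∈-descendants⁺ y v zero {w} vw yw = here (sym (dist≡0⇒≡ v w vw))
  ∈-descendants⁺ y v (suc m) {u} vu yu with between m 1 v u (trans vu (+-comm 1 m))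
  ... | w , vw , wu = ∈-concatMap⁺′ (∈-descendants⁺ y v m vw yw) (∈-outward⁺ y w u wu (trans yu (trans (+-suc _ m) (cong suc (sym yw)))))
    where
    yw : dist y w ≡ dist y v + m
    yw = ≤-antisym (subst (λ t → dist y w ≤ dist y v + t) vw (triangle y v w))
      (+-cancelʳ-≤ 1 _ _ (subst₂ _≤_ (trans yu (trans (+-suc _ m) (+-comm 1 _))) (cong (dist y w +_) wu) (triangle y w u)))

  descendants-unique : ∀ (y v : Vertex q) m → Unique (descendants y v m)
  descendants-unique y v zero    = All.[] ∷ []
  descendants-unique y v (suc m) = concatMap-unique (descendants-unique y v m)
    (λ {w} _ → Unique.filter⁺ (λ u → dist y u ≟ suc (dist y w)) (neighbours-unique w)) apart
    where
    apart : ∀ {w w′ u} → w ∈ descendants y v m → w′ ∈ descendants y v m → u ∈ outward y w → u ∈ outward y w′ → w ≡ w′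
    apart {w} {w′} {u} _ _ u∈ u∈′ with ∈-outward⁻ y w u∈ | ∈-outward⁻ y w′ u∈′
    ... | wu , yu | w′u , yu′ = between-unique y u w w′ (trans yu (+-comm 1 _)) refl wu (suc-injective (trans (sym yu′) yu)) w′u

  concatMap-length : ∀ {A B : Set} (f : A → List B) {k} xs → (∀ {x} → x ∈ xs → length (f x) ≡ k) → length (concatMap f xs) ≡ length xs * k
  concatMap-length f [] _ = refl
  concatMap-length f (x ∷ xs) h = trans (length-++ (f x)) (cong₂ _+_ (h (here refl)) (concatMap-length f xs (h ∘ there)))

  descendants-length : ∀ (y v : Vertex q) → y ≢ v → ∀ m → length (descendants y v m) ≡ q ^ m
  descendants-length y v y≢v zero = refl
  descendants-length {q} y v y≢v (suc m) = trans
    (concatMap-length (outward y) (descendants y v m) (λ {w} w∈ → outward-length y w (apart w∈)))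
    (trans (cong (_* q) (descendants-length y v y≢v m)) (*-comm (q ^ m) q))
    where
    apart : ∀ {w} → w ∈ descendants y v m → y ≢ w
    apart w∈ refl = y≢v (dist≡0⇒≡ y v (m+n≡0⇒m≡0 _ (trans (sym (proj₂ (∈-descendants⁻ y v m w∈))) (dist-refl y))))

  -- The sphere is a generation of descendants of its own centre; only the first step has q + 1
  -- choices, each later one has q.
  sphere-length : ∀ (x : Vertex q) m → length (sphere x (suc m)) ≡ suc q * q ^ m
  sphere-length {q} x m = trans (unique-length (sphere-unique x (suc m)) (descendants-unique x x (suc m))
      (λ v∈ → ∈-descendants⁺ x x (suc m) (∈-sphere⁻ x v∈) (trans (∈-sphere⁻ x v∈) (cong (_+ suc m) (sym (dist-refl x)))))
      (λ {v} v∈ → ∈-sphere⁺ x v (proj₁ (∈-descendants⁻ x x (suc m) v∈))))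
    (size m)
    where
    size : ∀ m → length (descendants x x (suc m)) ≡ suc q * q ^ m
    size zero = trans (concatMap-length (outward x) (x ∷ []) (λ { (here refl) → outward-length-self x })) (*-comm 1 (suc q))
    size (suc m) = trans
      (concatMap-length (outward x) (descendants x x (suc m)) (λ {w} w∈ → outward-length x w (apart w∈)))
      (trans (cong (_* q) (size m)) (trans (*-assoc (suc q) (q ^ m) q) (cong (suc q *_) (*-comm (q ^ m) q))))
      where
      apart : ∀ {w} → w ∈ descendants x x (suc m) → x ≢ w
      apart w∈ refl = 0≢1+n (trans (sym (dist-refl x)) (proj₁ (∈-descendants⁻ x x (suc m) w∈)))

  -- These are the vertices of the sphere around x whose geodesic from x shares its first j edges
  -- with the geodesic to y.
  sphere-tail : ∀ (x y : Vertex q) {d n} j m → dist x y ≡ d → 1 ≤ j → j ≤ d → j + m ≡ n →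
    length (filter (λ v → dist y v + 2 * j ≤? n + d) (sphere x n)) ≡ q ^ m
  sphere-tail {q} x y {d} j m xy 1≤j j≤d refl with between j (d ∸ j) x y (trans xy (sym (m+[n∸m]≡n j≤d)))
  ... | t , xt , ty = trans
    (unique-length (Unique.filter⁺ P? (sphere-unique x (j + m))) (descendants-unique x t m) to from)
    (descendants-length x t (λ { refl → <⇒≢ 1≤j (trans (sym (dist-refl x)) xt) }) m)
    where
    P? : Decidable (λ v → dist y v + 2 * j ≤ (j + m) + d)
    P? v = dist y v + 2 * j ≤? (j + m) + d
    k : ℕ
    k = d ∸ j
    k+j : k + j ≡ d
    k+j = m∸n+n≡m j≤d
    from : ∀ {v} → v ∈ descendants x t m → v ∈ filter P? (sphere x (j + m))
    from {v} v∈ with ∈-descendants⁻ x t m v∈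
    ... | tv , xv = ∈-filter⁺ P? (∈-sphere⁺ x v (trans xv (cong (_+ m) xt)))
      (linear 0 (+-mono-≤ (triangle y t v) (≤-reflexive k+j)) (trans (cong₂ (λ a b → dist y v + 2 * j + (a + b + d) + 0) (trans (dist-sym y t) ty) tv) (lemma (dist y v) j k m d)))
      where
      lemma : ∀ b j k m d → b + 2 * j + (k + m + d) + 0 ≡ j + m + d + (b + (k + j))
      lemma = solve-∀
    to : ∀ {v} → v ∈ filter P? (sphere x (j + m)) → v ∈ descendants x t m
    to {v} v∈ with ∈-filter⁻ P? {xs = sphere x (j + m)} v∈
    ... | v∈S , yv≤ = ∈-descendants⁺ x t m (≤-antisym upper lower) (trans xv (cong (_+ m) (sym xt)))
      where
      xv : dist x v ≡ j + m
      xv = ∈-sphere⁻ x v∈S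
      lower : m ≤ dist t v
      lower = +-cancelˡ-≤ j m (dist t v) (subst₂ _≤_ xv (cong (_+ dist t v) xt) (triangle x t v))
      lemma₁ : ∀ b j m d → j + b + (j + m + d) + 0 ≡ m + d + (b + 2 * j)
      lemma₁ = solve-∀
      lemma₂ : ∀ j k m → k + (j + m) ≡ m + (k + j)
      lemma₂ = solve-∀
      -- Four-point condition for `t`, `v` against `x`, `y`: the filter condition bounds dist t x +
      -- dist v y by m + d, and dist t y + dist v x equals m + d.
      upper : dist t v ≤ m
      upper = +-cancelʳ-≤ d (dist t v) m (subst (λ s → dist t v + s ≤ m + d) xy
        (four-point t v x y
          (subst (_≤ m + d) (cong₂ _+_ (trans (sym xt) (dist-sym x t)) (dist-sym y v)) (linear 0 yv≤ (lemma₁ (dist y v) j m d)))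
          (≤-reflexive (trans (cong₂ _+_ ty (trans (dist-sym v x) xv)) (trans (lemma₂ j k m) (cong (m +_) k+j))))))

  -- The potential: tightness and feasibility

  -- With b = dist Y v, the function v ↦ (potential n d b - d - 2n)/2 is an optimal Kantorovich
  -- potential on the sphere around X; the affine change keeps its values in ℕ, and the value at
  -- b = n makes it symmetric in X and Y.
  potential : (n d b : ℕ) → ℕ
  potential n d b with <-cmp b n
  ... | tri< _ _ _ = 2 * d
  ... | tri≈ _ _ _ = d + 2 * n
  ... | tri> _ _ _ = 2 * b + 2 * n

  potential-< : ∀ {n b} d → b < n → potential n d b ≡ 2 * d
  potential-< {n} {b} d b<n with <-cmp b n
  ... | tri< _ _ _    = refl
  ... | tri≈ ¬b<n _ _ = contradiction b<n ¬b<n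
  ... | tri> ¬b<n _ _ = contradiction b<n ¬b<n

  potential-≡ : ∀ {n b} d → b ≡ n → potential n d b ≡ d + 2 * n
  potential-≡ {n} {b} d b≡n with <-cmp b n
  ... | tri< _ b≢n _ = contradiction b≡n b≢n
  ... | tri≈ _ _ _   = refl
  ... | tri> _ b≢n _ = contradiction b≡n b≢n

  potential-> : ∀ {n b} d → n < b → potential n d b ≡ 2 * b + 2 * n
  potential-> {n} {b} d n<b with <-cmp b n
  ... | tri< _ _ ¬n<b = contradiction n<b ¬n<b
  ... | tri≈ _ _ ¬n<b = contradiction n<b ¬n<b
  ... | tri> _ _ _    = refl

  -- The two largest of three numbers coincide.
  record Isosceles (p q r : ℕ) : Set where
    field
      p≤ : ∀ {s} → q ≤ s → r ≤ s → p ≤ s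
      q≤ : ∀ {s} → p ≤ s → r ≤ s → q ≤ s
      r≤ : ∀ {s} → p ≤ s → q ≤ s → r ≤ s

    rotate : Isosceles q r p
    rotate = record { p≤ = λ h₁ h₂ → q≤ h₂ h₁ ; q≤ = λ h₁ h₂ → r≤ h₂ h₁ ; r≤ = p≤ }

    flip : Isosceles q p r
    flip = record { p≤ = q≤ ; q≤ = p≤ ; r≤ = λ h₁ h₂ → r≤ h₂ h₁ }

  isosceles-equal : ∀ {p q r} → Isosceles p q r → q < r → p ≡ r
  isosceles-equal {p} {q} {r} iso q<r = ≤-antisym (p≤ (<⇒≤ q<r) ≤-refl) (≮⇒≥ (smaller q<r))
    where
    open Isosceles iso
    smaller : q < r → ¬ p < r
    smaller (s≤s q≤) (s≤s p≤) = <-irrefl refl (r≤ p≤ q≤)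

  -- For v and w on the spheres of radius n around X and Y, where dist X Y = d:
  -- D = dist v w, b = dist Y v, a = dist X w.
  record Quadruple (n d D b a : ℕ) : Set where
    field
      d<n : d < n
      b≤  : b ≤ n + D
      a≤  : a ≤ n + D
      isosceles : Isosceles (D + d) (n + n) (a + b)

  -- Either `w` lies on the geodesic from `Y` to `v`, or `v` lies on the geodesic from `X` to `w`.
  Related : (n D b a : ℕ) → Set
  Related n D b a = D + n ≡ b ⊎ D + n ≡ a

  module _ {n d D b a} (quad : Quadruple n d D b a) where
    open Quadruple quad

    mirror : Quadruple n d D a b
    mirror = record { d<n = d<n ; b≤ = a≤ ; a≤ = b≤ ; isosceles = subst (Isosceles (D + d) (n + n)) (+-comm a b) isosceles }

    below⇒through : D + d < n + n → a + b ≡ n + n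
    below⇒through = isosceles-equal (Isosceles.rotate (Isosceles.rotate isosceles))

    -- From `d < n` follows D + d < D + n = b, so D + d is strictly the smallest sum and the other
    -- two must agree.
    related⇒throughˡ : D + n ≡ b → a + b ≡ n + n
    related⇒throughˡ refl = sym (isosceles-equal (Isosceles.flip isosceles) (linear a d<n (lemma D d n a)))
      where
      lemma : ∀ D d n a → suc (D + d) + n + a ≡ a + (D + n) + suc d
      lemma = solve-∀

  module _ {n d D b a} (quad : Quadruple n d D b a) where
    open Quadruple quad

    related⇒through : Related n D b a → a + b ≡ n + n
    related⇒through (inj₁ e) = related⇒throughˡ quad e
    related⇒through (inj₂ e) = trans (+-comm a b) (related⇒throughˡ (mirror quad) e)

    -- If `v` is between `X` and `w` instead, then a + b = 2n gives b ≤ n. The two cases thus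
    -- overlap only at b = n, where D = 0.
    related-≥ : Related n D b a → n ≤ b → D + n ≡ b
    related-≥ (inj₁ e) _ = e
    related-≥ R@(inj₂ refl) n≤b = ≤-antisym
      (linear 0 (+-mono-≤ (≤-reflexive (related⇒through R)) (+-mono-≤ n≤b n≤b)) (lemma₁ D n b))
      (linear (D + D) (≤-reflexive (related⇒through R)) (lemma₂ D n b))
      where
      lemma₁ : ∀ D n b → D + n + (n + n + (b + b)) + 0 ≡ b + (D + n + b + (n + n))
      lemma₁ = solve-∀
      lemma₂ : ∀ D n b → b + (n + n) + (D + D) ≡ D + n + (D + n + b)
      lemma₂ = solve-∀

    related-≤ : Related n D b a → b ≤ n → D + b ≡ n
    related-≤ R@(inj₂ refl) _ = +-cancelˡ-≡ n (D + b) n (trans (lemma D n b) (related⇒through R))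
      where
      lemma : ∀ D n b → n + (D + b) ≡ D + n + b
      lemma = solve-∀
    related-≤ (inj₁ refl) b≤n with n≤0⇒n≡0 (+-cancelʳ-≤ n D 0 b≤n)
    ... | refl = refl

    -- Here D ≤ n and d < n keep D + d below 2n, so a + b = 2n.
    completes : D + b ≡ n → D + n ≡ a
    completes e = +-cancelʳ-≡ b (D + n) a (trans (trans (lemma D n b) (cong (_+ n) e))
      (sym (below⇒through quad (+-mono-≤-< (m+n≤o⇒m≤o D (≤-reflexive e)) d<n))))
      where
      lemma : ∀ D n b → D + n + b ≡ D + b + n
      lemma = solve-∀

    beyond : n + n < a + b → D + d ≡ a + b
    beyond = isosceles-equal isosceles

    -- The right-hand side is D under the affine change: `potential` is twice the dual function plus
    -- d + 2n, and two copies are added. In dual terms (b - d/2) + (a - d/2) = D, which is `beyond`.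
    tight-> : n < b → n < a → potential n d b + potential n d a ≡ 2 * D + (2 * d + 4 * n)
    tight-> n<b n<a = trans (cong₂ _+_ (potential-> d n<b) (potential-> d n<a))
      (trans (lemma₁ n a b) (trans (cong (λ t → 2 * t + 4 * n) (sym (beyond (+-mono-< n<a n<b)))) (lemma₂ D d n)))
      where
      lemma₁ : ∀ n a b → 2 * b + 2 * n + (2 * a + 2 * n) ≡ 2 * (a + b) + 4 * n
      lemma₁ = solve-∀
      lemma₂ : ∀ D d n → 2 * (D + d) + 4 * n ≡ 2 * D + (2 * d + 4 * n)
      lemma₂ = solve-∀

    -- For D = 0 one has a = b = n, where the dual function is 0. For D > 0 one has b > n > a, and
    -- the dual values D + n - d/2 and d/2 - n add up to D.
    tight-relatedˡ : D + n ≡ b → potential n d b + potential n d a ≡ 2 * D + (2 * d + 4 * n)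
    tight-relatedˡ refl = go D refl
      where
      a+b : a + (D + n) ≡ n + n
      a+b = related⇒throughˡ quad refl
      lemma : ∀ D d n → 2 * (D + n) + 2 * n + 2 * d ≡ 2 * D + (2 * d + 4 * n)
      lemma = solve-∀
      lemma₀ : ∀ d n → d + 2 * n + (d + 2 * n) ≡ 2 * 0 + (2 * d + 4 * n)
      lemma₀ = solve-∀
      go : ∀ E → D ≡ E → potential n d (D + n) + potential n d a ≡ 2 * D + (2 * d + 4 * n)
      go zero refl = trans (cong₂ _+_ (potential-≡ {n} d refl) (potential-≡ d (+-cancelʳ-≡ n a n a+b))) (lemma₀ d n)
      go (suc E) refl = trans (cong₂ _+_ (potential-> d (s≤s (m≤n+m n E)))
          (potential-< {n} {a} d (linear E (≤-reflexive a+b) (lemma₁ a n E)))) (lemma D d n)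
        where
        lemma₁ : ∀ a n E → suc a + (n + n) + E ≡ n + (a + (suc E + n))
        lemma₁ = solve-∀

  tight-related : ∀ {n d D b a} → Quadruple n d D b a → Related n D b a → potential n d b + potential n d a ≡ 2 * D + (2 * d + 4 * n)
  tight-related quad (inj₁ e) = tight-relatedˡ quad e
  tight-related {n} {d} {D} {b} {a} quad (inj₂ e) = trans (+-comm (potential n d b) (potential n d a)) (tight-relatedˡ (mirror quad) e)

  module _ {n d D b a} (quad : Quadruple n d D b a) where
    open Quadruple quad

    private
      d≤n : d ≤ n
      d≤n = <⇒≤ d<n

    -- In dual terms (d/2 - n) + (a - d/2) = a - n, and a - n ≤ D is the triangle inequality.
    dominated-<> : b < n → n < a → potential n d b + potential n d a ≤ 2 * D + (2 * d + 4 * n)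
    dominated-<> b<n n<a rewrite potential-< d b<n | potential-> d n<a = linear 0 (+-mono-≤ a≤ a≤) (lemma n d D a)
      where
      lemma : ∀ n d D a → 2 * d + (2 * a + 2 * n) + (n + D + (n + D)) + 0 ≡ 2 * D + (2 * d + 4 * n) + (a + a)
      lemma = solve-∀

    dominated-<≡ : b < n → a ≡ n → potential n d b + potential n d a ≤ 2 * D + (2 * d + 4 * n)
    dominated-<≡ b<n a≡n rewrite potential-< d b<n | potential-≡ d a≡n = linear (2 * D + n) d≤n (lemma n d D)
      where
      lemma : ∀ n d D → 2 * d + (d + 2 * n) + n + (2 * D + n) ≡ 2 * D + (2 * d + 4 * n) + d
      lemma = solve-∀

    -- In dual terms a - d/2 ≤ D. Since `beyond` gives D = a + n - d, the slack is n - d/2.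
    dominated-≡> : b ≡ n → n < a → potential n d b + potential n d a ≤ 2 * D + (2 * d + 4 * n)
    dominated-≡> refl n<a rewrite potential-≡ {n} d refl | potential-> d n<a = linear n
      (+-mono-≤ d≤n (+-mono-≤ ≤D+d ≤D+d)) (lemma n d D a)
      where
      ≤D+d : a + n ≤ D + d
      ≤D+d = ≤-reflexive (sym (beyond quad (+-monoˡ-< n n<a)))
      lemma : ∀ n d D a → d + 2 * n + (2 * a + 2 * n) + (n + (D + d + (D + d))) + n ≡ 2 * D + (2 * d + 4 * n) + (d + (a + n + (a + n)))
      lemma = solve-∀

    dominated-<< : b < n → a < n → potential n d b + potential n d a ≤ 2 * D + (2 * d + 4 * n)
    dominated-<< b<n a<n rewrite potential-< d b<n | potential-< d a<n = linear (2 * D + 2 * n) (+-mono-≤ d≤n d≤n) (lemma n d D)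
      where
      lemma : ∀ n d D → 2 * d + 2 * d + (n + n) + (2 * D + 2 * n) ≡ 2 * D + (2 * d + 4 * n) + (d + d)
      lemma = solve-∀

    dominated-≡≡ : b ≡ n → a ≡ n → potential n d b + potential n d a ≤ 2 * D + (2 * d + 4 * n)
    dominated-≡≡ b≡n a≡n rewrite potential-≡ d b≡n | potential-≡ d a≡n = linear (2 * D) z≤n (lemma n d D)
      where
      lemma : ∀ n d D → d + 2 * n + (d + 2 * n) + 0 + 2 * D ≡ 2 * D + (2 * d + 4 * n) + 0
      lemma = solve-∀

  dominated : ∀ {n d D b a} → Quadruple n d D b a → potential n d b + potential n d a ≤ 2 * D + (2 * d + 4 * n)
  dominated {n} {d} {D} {b} {a} quad = go (<-cmp b n) (<-cmp a n)
    where
    swapped : potential n d a + potential n d b ≤ 2 * D + (2 * d + 4 * n) → potential n d b + potential n d a ≤ 2 * D + (2 * d + 4 * n)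
    swapped = subst (_≤ 2 * D + (2 * d + 4 * n)) (+-comm (potential n d a) (potential n d b))
    go : Tri (b < n) (b ≡ n) (n < b) → Tri (a < n) (a ≡ n) (n < a) → potential n d b + potential n d a ≤ 2 * D + (2 * d + 4 * n)
    go (tri< b< _ _) (tri< a< _ _) = dominated-<< quad b< a<
    go (tri< b< _ _) (tri≈ _ a≡ _) = dominated-<≡ quad b< a≡
    go (tri< b< _ _) (tri> _ _ a>) = dominated-<> quad b< a>
    go (tri≈ _ b≡ _) (tri< a< _ _) = swapped (dominated-<≡ (mirror quad) a< b≡)
    go (tri≈ _ b≡ _) (tri≈ _ a≡ _) = dominated-≡≡ quad b≡ a≡
    go (tri≈ _ b≡ _) (tri> _ _ a>) = dominated-≡> quad b≡ a>
    go (tri> _ _ b>) (tri< a< _ _) = swapped (dominated-<> (mirror quad) a< b>)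
    go (tri> _ _ b>) (tri≈ _ a≡ _) = swapped (dominated-≡> (mirror quad) a≡ b>)
    go (tri> _ _ b>) (tri> _ _ a>) = ≤-reflexive (tight-> quad b> a>)

  -- The three sums in `isosceles` are the three ways to pair off `v`, `w`, `X`, `Y`; each field is
  -- the four-point condition for one of them.
  quadruple : ∀ {n d} (X Y v w : Vertex q) → dist X Y ≡ d → d < n → dist X v ≡ n → dist Y w ≡ n →
    Quadruple n d (dist v w) (dist Y v) (dist X w)
  quadruple {n = n} {d} X Y v w refl d<n refl Yw = record
    { d<n = d<n
    ; b≤ = subst₂ (λ s t → dist Y v ≤ s + t) Yw (dist-sym w v) (triangle Y w v)
    ; a≤ = triangle X v w
    ; isosceles = record
      { p≤ = λ {s} h₁ h₂ → four-point v w X Y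
          (subst (_≤ s) (cong₂ _+_ (dist-sym X v) (trans (sym Yw) (dist-sym Y w))) h₁)
          (subst (_≤ s) (trans (+-comm (dist X w) (dist Y v)) (cong₂ _+_ (dist-sym Y v) (dist-sym X w))) h₂)
      ; q≤ = λ {s} h₁ h₂ → subst (λ t → dist X v + t ≤ s) Yw (four-point X v Y w
          (subst (_≤ s) (+-comm (dist v w) (dist X Y)) h₁)
          (subst (λ t → dist X w + t ≤ s) (dist-sym Y v) h₂))
      ; r≤ = λ {s} h₁ h₂ → four-point X w Y v
          (subst (_≤ s) (trans (+-comm (dist v w) (dist X Y)) (cong (dist X Y +_) (dist-sym v w))) h₁)
          (subst (_≤ s) (cong (dist X v +_) (trans (sym Yw) (dist-sym Y w))) h₂)
      }
    }

open Tree

module Transportation where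

  import Data.Integer as ℤ
  import Data.Integer.Properties as ℤ
  open import Data.Nat as ℕ using (ℕ; zero; suc; _^_; ⌊_/2⌋; ⌈_/2⌉; z≤n; s≤s)
  import Data.Nat.Properties as ℕ
  open import Data.Rational
  open import Data.Rational.Properties
  open import Data.Rational.Solver using (module +-*-Solver)
  open import Data.Rational.Unnormalised as ℚᵘ using (mkℚᵘ; *≡*; *≤*)
  import Data.Rational.Unnormalised.Properties as ℚᵘ

  private variable
    q : ℕ

  -- Arithmetic of rationals and finite sums

  toℚᵘ-ℕ→ℚ : ∀ m → toℚᵘ (ℕ→ℚ m) ℚᵘ.≃ mkℚᵘ (ℤ.+ m) 0
  toℚᵘ-ℕ→ℚ m = toℚᵘ-fromℚᵘ (mkℚᵘ (ℤ.+ m) 0)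

  ℕ→ℚ-+ : ∀ m n → ℕ→ℚ (m ℕ.+ n) ≡ ℕ→ℚ m + ℕ→ℚ n
  ℕ→ℚ-+ m n = toℚᵘ-injective (begin
    toℚᵘ (ℕ→ℚ (m ℕ.+ n))            ≈⟨ toℚᵘ-ℕ→ℚ (m ℕ.+ n) ⟩
    mkℚᵘ (ℤ.+ (m ℕ.+ n)) 0            ≈⟨ *≡* (cong (ℤ._* ℤ.+ 1) (cong₂ ℤ._+_ (sym (ℤ.*-identityʳ (ℤ.+ m))) (sym (ℤ.*-identityʳ (ℤ.+ n))))) ⟩
    mkℚᵘ (ℤ.+ m) 0 ℚᵘ.+ mkℚᵘ (ℤ.+ n) 0  ≈⟨ ℚᵘ.+-cong (toℚᵘ-ℕ→ℚ m) (toℚᵘ-ℕ→ℚ n) ⟨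
    toℚᵘ (ℕ→ℚ m) ℚᵘ.+ toℚᵘ (ℕ→ℚ n)  ≈⟨ toℚᵘ-homo-+ (ℕ→ℚ m) (ℕ→ℚ n) ⟨
    toℚᵘ (ℕ→ℚ m + ℕ→ℚ n)            ∎)
    where open ℚᵘ.≃-Reasoning

  ℕ→ℚ-* : ∀ m n → ℕ→ℚ (m ℕ.* n) ≡ ℕ→ℚ m * ℕ→ℚ n
  ℕ→ℚ-* m n = toℚᵘ-injective (begin
    toℚᵘ (ℕ→ℚ (m ℕ.* n))            ≈⟨ toℚᵘ-ℕ→ℚ (m ℕ.* n) ⟩
    mkℚᵘ (ℤ.+ (m ℕ.* n)) 0            ≈⟨ *≡* (cong (ℤ._* ℤ.+ 1) (ℤ.pos-* m n)) ⟩
    mkℚᵘ (ℤ.+ m) 0 ℚᵘ.* mkℚᵘ (ℤ.+ n) 0  ≈⟨ ℚᵘ.*-cong (toℚᵘ-ℕ→ℚ m) (toℚᵘ-ℕ→ℚ n) ⟨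
    toℚᵘ (ℕ→ℚ m) ℚᵘ.* toℚᵘ (ℕ→ℚ n)  ≈⟨ toℚᵘ-homo-* (ℕ→ℚ m) (ℕ→ℚ n) ⟨
    toℚᵘ (ℕ→ℚ m * ℕ→ℚ n)            ∎)
    where open ℚᵘ.≃-Reasoning

  ℕ→ℚ-mono : ∀ {m n} → m ℕ.≤ n → ℕ→ℚ m ≤ ℕ→ℚ n
  ℕ→ℚ-mono {m} {n} m≤n = toℚᵘ-cancel-≤ (begin
    toℚᵘ (ℕ→ℚ m)  ≃⟨ toℚᵘ-ℕ→ℚ m ⟩
    mkℚᵘ (ℤ.+ m) 0  ≤⟨ *≤* (ℤ.*-monoʳ-≤-nonNeg (ℤ.+ 1) (ℤ.+≤+ m≤n)) ⟩
    mkℚᵘ (ℤ.+ n) 0  ≃⟨ toℚᵘ-ℕ→ℚ n ⟨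
    toℚᵘ (ℕ→ℚ n)  ∎)
    where open ℚᵘ.≤-Reasoning

  ℕ→ℚ*inv : ∀ m → 0 ℕ.< m → ℕ→ℚ m * inv m ≡ 1ℚ
  ℕ→ℚ*inv (suc m) _ = toℚᵘ-injective (begin
    toℚᵘ (ℕ→ℚ (suc m) * inv (suc m))            ≈⟨ toℚᵘ-homo-* (ℕ→ℚ (suc m)) (inv (suc m)) ⟩
    toℚᵘ (ℕ→ℚ (suc m)) ℚᵘ.* toℚᵘ (inv (suc m))  ≈⟨ ℚᵘ.*-cong (toℚᵘ-ℕ→ℚ (suc m)) (toℚᵘ-fromℚᵘ (mkℚᵘ (ℤ.+ 1) m)) ⟩
    mkℚᵘ (ℤ.+ suc m) 0 ℚᵘ.* mkℚᵘ (ℤ.+ 1) m          ≈⟨ *≡* (trans (trans (ℤ.*-identityʳ _) (ℤ.*-identityʳ _)) (sym (trans (ℤ.*-identityˡ _) (cong (λ k → ℤ.+ suc k) (ℕ.+-identityʳ m))))) ⟩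
    ℚᵘ.1ℚᵘ                                      ∎)
    where open ℚᵘ.≃-Reasoning

  0≤inv : ∀ m → 0ℚ ≤ inv m
  0≤inv zero    = ≤-refl
  0≤inv (suc m) = nonNegative⁻¹ (inv (suc m)) ⦃ normalize-nonNeg 1 (suc m) ⦄

  0≤* : ∀ {p q} → 0ℚ ≤ p → 0ℚ ≤ q → 0ℚ ≤ p * q
  0≤* {p} {q} 0≤p 0≤q = nonNegative⁻¹ (p * q) ⦃ nonNeg*nonNeg⇒nonNeg p ⦃ nonNegative 0≤p ⦄ q ⦃ nonNegative 0≤q ⦄ ⦄

  0≤- : ∀ {p q} → p ≤ q → 0ℚ ≤ q - p
  0≤- {p} {q} p≤q = subst (_≤ q - p) (+-inverseʳ p) (+-monoˡ-≤ (- p) p≤q)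

  module _ {A : Set} where

    Σ-cong : ∀ (xs : List A) {f g} → (∀ {x} → x ∈ xs → f x ≡ g x) → Σ[ xs ] f ≡ Σ[ xs ] g
    Σ-cong []       h = refl
    Σ-cong (x ∷ xs) h = cong₂ _+_ (h (here refl)) (Σ-cong xs (h ∘ there))

    Σ-mono : ∀ (xs : List A) {f g} → (∀ {x} → x ∈ xs → f x ≤ g x) → Σ[ xs ] f ≤ Σ[ xs ] g
    Σ-mono []       h = ≤-refl
    Σ-mono (x ∷ xs) h = +-mono-≤ (h (here refl)) (Σ-mono xs (h ∘ there))

    Σ-+ : ∀ (xs : List A) f g → Σ[ xs ] (λ x → f x + g x) ≡ Σ[ xs ] f + Σ[ xs ] g
    Σ-+ [] f g = refl
    Σ-+ (x ∷ xs) f g = trans (cong (f x + g x +_) (Σ-+ xs f g))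
      (solve 4 (λ a b c d → (a :+ b) :+ (c :+ d) := (a :+ c) :+ (b :+ d)) refl (f x) (g x) (Σ[ xs ] f) (Σ[ xs ] g))
      where open +-*-Solver

    Σ-* : ∀ (xs : List A) c f → Σ[ xs ] (λ x → c * f x) ≡ c * Σ[ xs ] f
    Σ-* [] c f = sym (*-zeroʳ c)
    Σ-* (x ∷ xs) c f = trans (cong (c * f x +_) (Σ-* xs c f)) (sym (*-distribˡ-+ c (f x) (Σ[ xs ] f)))

    Σ-*ʳ : ∀ (xs : List A) c f → Σ[ xs ] (λ x → f x * c) ≡ (Σ[ xs ] f) * c
    Σ-*ʳ xs c f = trans (Σ-cong xs (λ {x} _ → *-comm (f x) c)) (trans (Σ-* xs c f) (*-comm c _))

    Σ-0 : ∀ (xs : List A) → Σ[ xs ] (λ _ → 0ℚ) ≡ 0ℚ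
    Σ-0 []       = refl
    Σ-0 (x ∷ xs) = trans (+-identityˡ _) (Σ-0 xs)

    Σ-const : ∀ (xs : List A) c → Σ[ xs ] (λ _ → c) ≡ ℕ→ℚ (length xs) * c
    Σ-const [] c = sym (*-zeroˡ c)
    Σ-const (x ∷ xs) c = trans (cong (c +_) (Σ-const xs c)) (sym (trans (cong (_* c) (ℕ→ℚ-+ 1 (length xs)))
      (solve 2 (λ l c → (con 1ℚ :+ l) :* c := c :+ l :* c) refl (ℕ→ℚ (length xs)) c)))
      where open +-*-Solver

    Σ-indicator : ∀ {P : A → Set} (P? : Decidable P) xs c →
      Σ[ xs ] (λ x → if does (P? x) then c else 0ℚ) ≡ ℕ→ℚ (length (filter P? xs)) * c
    Σ-indicator P? [] c = sym (*-zeroˡ c)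
    Σ-indicator P? (x ∷ xs) c with does (P? x)
    ... | false = trans (+-identityˡ _) (Σ-indicator P? xs c)
    ... | true  = trans (cong (c +_) (trans (Σ-indicator P? xs c) (sym (Σ-const (filter P? xs) c)))) (Σ-const (x ∷ filter P? xs) c)

    Σ-nonNeg : ∀ (xs : List A) {f} → (∀ {x} → x ∈ xs → 0ℚ ≤ f x) → 0ℚ ≤ Σ[ xs ] f
    Σ-nonNeg xs {f} h = subst (_≤ Σ[ xs ] f) (Σ-0 xs) (Σ-mono xs h)

    Σ≡0⇒≡0 : ∀ (xs : List A) {f} → (∀ {x} → x ∈ xs → 0ℚ ≤ f x) → Σ[ xs ] f ≡ 0ℚ → ∀ {x} → x ∈ xs → f x ≡ 0ℚ
    Σ≡0⇒≡0 (x ∷ xs) {f} h e x∈ = go x∈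
      where
      fx≤0 : f x ≤ 0ℚ
      fx≤0 = subst₂ _≤_ (+-identityʳ (f x)) e (+-monoʳ-≤ (f x) (Σ-nonNeg xs (h ∘ there)))
      fx≡0 : f x ≡ 0ℚ
      fx≡0 = ≤-antisym fx≤0 (h (here refl))
      go : ∀ {y} → y ∈ x ∷ xs → f y ≡ 0ℚ
      go (here refl) = fx≡0
      go (there y∈)  = Σ≡0⇒≡0 xs (h ∘ there) (trans (sym (trans (cong (_+ Σ[ xs ] f) fx≡0) (+-identityˡ _))) e) y∈

  Σ-swap : ∀ {A B : Set} (xs : List A) (ys : List B) (f : A → B → ℚ) →
    Σ[ xs ] (λ x → Σ[ ys ] (λ y → f x y)) ≡ Σ[ ys ] (λ y → Σ[ xs ] (λ x → f x y))
  Σ-swap [] ys f = sym (Σ-0 ys)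
  Σ-swap (x ∷ xs) ys f = trans (cong (Σ[ ys ] (f x) +_) (Σ-swap xs ys f)) (sym (Σ-+ ys (f x) (λ y → Σ[ xs ] (λ x → f x y))))

  -- Duality for finite transport problems

  module _ {A : Set} (μ ν : FinMeasure A) where

    private
      S = support μ
      T = support ν

    -- A separated integrand sees only the marginals, so its integral is the same for every
    -- coupling.
    coupling-potential : ∀ {π} → IsCoupling μ ν π → ∀ (F G : A → ℚ) →
      Σ[ S ] (λ v → Σ[ T ] (λ w → (F v + G w) * π v w)) ≡ Σ[ S ] (λ v → F v * mass μ v) + Σ[ T ] (λ w → G w * mass ν w)
    coupling-potential {π} (_ , rows , cols) F G = begin
      Σ[ S ] (λ v → Σ[ T ] (λ w → (F v + G w) * π v w))
        ≡⟨ Σ-cong S (λ {v} _ → trans (Σ-cong T (λ {w} _ → *-distribʳ-+ (π v w) (F v) (G w))) (Σ-+ T _ _)) ⟩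
      Σ[ S ] (λ v → Σ[ T ] (λ w → F v * π v w) + Σ[ T ] (λ w → G w * π v w))
        ≡⟨ Σ-+ S _ _ ⟩
      Σ[ S ] (λ v → Σ[ T ] (λ w → F v * π v w)) + Σ[ S ] (λ v → Σ[ T ] (λ w → G w * π v w))
        ≡⟨ cong₂ _+_ (Σ-cong S (λ {v} v∈ → trans (Σ-* T (F v) (π v)) (cong (F v *_) (rows v v∈))))
                     (trans (Σ-swap S T (λ v w → G w * π v w)) (Σ-cong T (λ {w} w∈ → trans (Σ-* S (G w) (λ v → π v w)) (cong (G w *_) (cols w w∈))))) ⟩
      Σ[ S ] (λ v → F v * mass μ v) + Σ[ T ] (λ w → G w * mass ν w) ∎
      where open ≡-Reasoning

    weak-duality : ∀ (k : A → A → ℚ) (F G : A → ℚ) → (∀ {v w} → v ∈ S → w ∈ T → F v + G w ≤ k v w) →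
      ∀ {π} → IsCoupling μ ν π →
      Σ[ S ] (λ v → F v * mass μ v) + Σ[ T ] (λ w → G w * mass ν w) ≤ Σ[ S ] (λ v → Σ[ T ] (λ w → k v w * π v w))
    weak-duality k F G F+G≤k {π} coupling@(0≤π , _) = ≤-trans (≤-reflexive (sym (coupling-potential coupling F G)))
      (Σ-mono S (λ {v} v∈ → Σ-mono T (λ {w} w∈ → *-monoʳ-≤-nonNeg (π v w) ⦃ nonNegative (0≤π v w) ⦄ (F+G≤k v∈ w∈))))

    -- A partial coupling `π₀` leaves excess mass on both sides, with the same total `E`. Adding the
    -- product of the two excesses divided by `E` restores both marginals.
    module Completion (π₀ : A → A → ℚ) (0≤π₀ : ∀ v w → 0ℚ ≤ π₀ v w)
      (rows≤ : ∀ {v} → v ∈ S → Σ[ T ] (λ w → π₀ v w) ≤ mass μ v)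
      (cols≤ : ∀ {w} → w ∈ T → Σ[ S ] (λ v → π₀ v w) ≤ mass ν w)
      (total : Σ[ S ] (mass μ) ≡ Σ[ T ] (mass ν)) where

      excessˡ excessʳ : A → ℚ
      excessˡ v = mass μ v - Σ[ T ] (λ w → π₀ v w)
      excessʳ w = mass ν w - Σ[ S ] (λ v → π₀ v w)

      private
        E : ℚ
        E = Σ[ S ] excessˡ

        Σ-minus : ∀ (xs : List A) f g → Σ[ xs ] (λ x → f x - g x) ≡ Σ[ xs ] f - Σ[ xs ] g
        Σ-minus [] f g = refl
        Σ-minus (x ∷ xs) f g = trans (cong (f x - g x +_) (Σ-minus xs f g))
          (solve 4 (λ a b c d → (a :- b) :+ (c :- d) := (a :+ c) :- (b :+ d)) refl (f x) (g x) (Σ[ xs ] f) (Σ[ xs ] g))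
          where open +-*-Solver

        E≡ : Σ[ T ] excessʳ ≡ E
        E≡ = sym (trans (Σ-minus S (mass μ) _) (trans (cong₂ _-_ total (Σ-swap S T π₀)) (sym (Σ-minus T (mass ν) _))))

      0≤excessˡ : ∀ {v} → v ∈ S → 0ℚ ≤ excessˡ v
      0≤excessˡ = 0≤- ∘ rows≤

      0≤excessʳ : ∀ {w} → w ∈ T → 0ℚ ≤ excessʳ w
      0≤excessʳ = 0≤- ∘ cols≤

      private
        -- t is 1/E, except that it is 0 when E = 0.
        normaliser : ∃ λ t → 0ℚ ≤ t × (∀ {v} → v ∈ S → excessˡ v * (E * t) ≡ excessˡ v) × (∀ {w} → w ∈ T → excessʳ w * (E * t) ≡ excessʳ w)
        normaliser with E ≟ 0ℚ
        ... | yes E≡0 = 0ℚ , ≤-refl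
          , (λ {v} v∈ → let e = Σ≡0⇒≡0 S 0≤excessˡ E≡0 v∈ in trans (cong (_* (E * 0ℚ)) e) (trans (*-zeroˡ (E * 0ℚ)) (sym e)))
          , (λ {w} w∈ → let e = Σ≡0⇒≡0 T 0≤excessʳ (trans E≡ E≡0) w∈ in trans (cong (_* (E * 0ℚ)) e) (trans (*-zeroˡ (E * 0ℚ)) (sym e)))
        ... | no E≢0 = t , 0≤t , (λ _ → cancel _) , (λ _ → cancel _)
          where
          instance
            E-nonZero : NonZero E
            E-nonZero = ≢-nonZero E≢0
            E-nonNeg : NonNegative E
            E-nonNeg = nonNegative (Σ-nonNeg S 0≤excessˡ)
            E-pos : Positive E
            E-pos = nonNeg∧nonZero⇒pos E
          t : ℚ
          t = 1/ E
          0≤t : 0ℚ ≤ t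
          0≤t = nonNegative⁻¹ t ⦃ pos⇒nonNeg t ⦃ 1/pos⇒pos E ⦄ ⦄
          cancel : ∀ e → e * (E * t) ≡ e
          cancel e = trans (cong (e *_) (*-inverseʳ E)) (*-identityʳ e)

        t : ℚ
        t = proj₁ normaliser

        -- Truncation makes the density nonnegative off the supports as well.
        π : A → A → ℚ
        π v w = π₀ v w + (0ℚ ⊔ excessˡ v) * ((0ℚ ⊔ excessʳ w) * t)

        π≡ : ∀ {v w} → v ∈ S → w ∈ T → π v w ≡ π₀ v w + excessˡ v * (excessʳ w * t)
        π≡ {v} {w} v∈ w∈ = cong₂ (λ a b → π₀ v w + a * (b * t)) (p≤q⇒p⊔q≡q (0≤excessˡ v∈)) (p≤q⇒p⊔q≡q (0≤excessʳ w∈))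

        0≤π : ∀ v w → 0ℚ ≤ π v w
        0≤π v w = +-mono-≤ (0≤π₀ v w) (0≤* (p≤p⊔q 0ℚ (excessˡ v)) (0≤* (p≤p⊔q 0ℚ (excessʳ w)) (proj₁ (proj₂ normaliser))))

        row-sum : ∀ v → v ∈ S → Σ[ T ] (π v) ≡ mass μ v
        row-sum v v∈ = begin
          Σ[ T ] (π v)                                                     ≡⟨ Σ-cong T (π≡ v∈) ⟩
          Σ[ T ] (λ w → π₀ v w + excessˡ v * (excessʳ w * t))              ≡⟨ Σ-+ T (π₀ v) _ ⟩
          Σ[ T ] (π₀ v) + Σ[ T ] (λ w → excessˡ v * (excessʳ w * t))       ≡⟨ cong (Σ[ T ] (π₀ v) +_) (Σ-* T (excessˡ v) _) ⟩
          Σ[ T ] (π₀ v) + excessˡ v * Σ[ T ] (λ w → excessʳ w * t)         ≡⟨ cong (λ s → Σ[ T ] (π₀ v) + excessˡ v * s) (trans (Σ-*ʳ T t excessʳ) (cong (_* t) E≡)) ⟩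
          Σ[ T ] (π₀ v) + excessˡ v * (E * t)                              ≡⟨ cong (Σ[ T ] (π₀ v) +_) (proj₁ (proj₂ (proj₂ normaliser)) v∈) ⟩
          Σ[ T ] (π₀ v) + excessˡ v                                        ≡⟨ solve 2 (λ a b → a :+ (b :- a) := b) refl (Σ[ T ] (π₀ v)) (mass μ v) ⟩
          mass μ v                                                         ∎
          where
          open ≡-Reasoning
          open +-*-Solver

        column-sum : ∀ w → w ∈ T → Σ[ S ] (λ v → π v w) ≡ mass ν w
        column-sum w w∈ = begin
          Σ[ S ] (λ v → π v w)                                             ≡⟨ Σ-cong S (λ v∈ → π≡ v∈ w∈) ⟩
          Σ[ S ] (λ v → π₀ v w + excessˡ v * (excessʳ w * t))              ≡⟨ Σ-+ S π₀w _ ⟩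
          Σ[ S ] π₀w + Σ[ S ] (λ v → excessˡ v * (excessʳ w * t))          ≡⟨ cong (Σ[ S ] π₀w +_) (Σ-*ʳ S (excessʳ w * t) excessˡ) ⟩
          Σ[ S ] π₀w + E * (excessʳ w * t)                                 ≡⟨ cong (Σ[ S ] π₀w +_) (solve 3 (λ a b c → a :* (b :* c) := b :* (a :* c)) refl E (excessʳ w) t) ⟩
          Σ[ S ] π₀w + excessʳ w * (E * t)                                 ≡⟨ cong (Σ[ S ] π₀w +_) (proj₂ (proj₂ (proj₂ normaliser)) w∈) ⟩
          Σ[ S ] π₀w + excessʳ w                                           ≡⟨ solve 2 (λ a b → a :+ (b :- a) := b) refl (Σ[ S ] π₀w) (mass ν w) ⟩
          mass ν w                                                         ∎
          where
          open ≡-Reasoning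
          open +-*-Solver
          π₀w : A → ℚ
          π₀w v = π₀ v w

      -- Complementary slackness for the two summands of `π`: `slack₀` makes `π₀` live on tight
      -- pairs, and the product term vanishes as soon as one excess does, which leaves only pairs
      -- that are tight by `slack`.
      strong-duality : ∀ (k : A → A → ℚ) (F G : A → ℚ) →
        (∀ {v w} → v ∈ S → w ∈ T → k v w * π₀ v w ≡ (F v + G w) * π₀ v w) →
        (∀ {v w} → v ∈ S → w ∈ T → excessˡ v ≡ 0ℚ ⊎ excessʳ w ≡ 0ℚ ⊎ k v w ≡ F v + G w) →
        ∃ λ π → IsCoupling μ ν π ×
          Σ[ S ] (λ v → Σ[ T ] (λ w → k v w * π v w)) ≡ Σ[ S ] (λ v → F v * mass μ v) + Σ[ T ] (λ w → G w * mass ν w)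
      strong-duality k F G slack₀ slack = π , coupling ,
        trans (Σ-cong S (λ {v} v∈ → Σ-cong T (λ {w} w∈ → tight v∈ w∈))) (coupling-potential coupling F G)
        where
        coupling : IsCoupling μ ν π
        coupling = 0≤π , row-sum , column-sum

        vanishing : ∀ x y e f t → e ≡ 0ℚ ⊎ f ≡ 0ℚ ⊎ x ≡ y → x * (e * (f * t)) ≡ y * (e * (f * t))
        vanishing x y e f t (inj₁ refl) = solve 4 (λ x y f t → x :* (con 0ℚ :* (f :* t)) := y :* (con 0ℚ :* (f :* t))) refl x y f t
          where open +-*-Solver
        vanishing x y e f t (inj₂ (inj₁ refl)) = solve 4 (λ x y e t → x :* (e :* (con 0ℚ :* t)) := y :* (e :* (con 0ℚ :* t))) refl x y e t
          where open +-*-Solver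
        vanishing x y e f t (inj₂ (inj₂ refl)) = refl

        tight : ∀ {v w} → v ∈ S → w ∈ T → k v w * π v w ≡ (F v + G w) * π v w
        tight {v} {w} v∈ w∈ = begin
          k v w * π v w                                                             ≡⟨ cong (k v w *_) (π≡ v∈ w∈) ⟩
          k v w * (π₀ v w + excessˡ v * (excessʳ w * t))                            ≡⟨ *-distribˡ-+ (k v w) (π₀ v w) _ ⟩
          k v w * π₀ v w + k v w * (excessˡ v * (excessʳ w * t))                    ≡⟨ cong₂ _+_ (slack₀ v∈ w∈) (vanishing (k v w) (F v + G w) (excessˡ v) (excessʳ w) t (slack v∈ w∈)) ⟩
          (F v + G w) * π₀ v w + (F v + G w) * (excessˡ v * (excessʳ w * t))        ≡⟨ *-distribˡ-+ (F v + G w) (π₀ v w) _ ⟨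
          (F v + G w) * (π₀ v w + excessˡ v * (excessʳ w * t))                      ≡⟨ cong ((F v + G w) *_) (π≡ v∈ w∈) ⟨
          (F v + G w) * π v w                                                       ∎
          where open ≡-Reasoning

  -- The coupling of the mass that stays

  if-cong : ∀ {P : Set} (P? : Dec P) {x y z : ℚ} → (P → x ≡ y) → (if does P? then x else z) ≡ (if does P? then y else z)
  if-cong (yes p) x≡y = x≡y p
  if-cong (no _)  x≡y = refl

  related? : ∀ n D b a → Dec (Related n D b a)
  related? n D b a = (D ℕ.+ n ℕ.≟ b) ⊎-dec (D ℕ.+ n ℕ.≟ a)

  -- The mass that stays on one side of the midpoint of the geodesic from X to Y: it moves
  -- along geodesics towards or away from the midpoint, at the same rate to all descendants.
  staying : (X Y : Vertex q) (n : ℕ) (c : ℚ) → Vertex q → Vertex q → ℚ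
  staying {q} X Y n c v w = if does (related? n (dist v w) (dist Y v) (dist X w)) then c * inv (q ^ dist v w) else 0ℚ

  -- Exchanging the centres exchanges the two alternatives of `Related`; column sums thereby become
  -- row sums for the exchanged centres.
  staying-swap : ∀ (X Y : Vertex q) n c v w → staying X Y n c v w ≡ staying Y X n c w v
  staying-swap {q} X Y n c v w rewrite dist-sym v w =
    cong (λ b → if b then c * inv (q ^ dist w v) else 0ℚ) (∨-comm (dist w v ℕ.+ n ℕ.≡ᵇ dist Y v) (dist w v ℕ.+ n ℕ.≡ᵇ dist X w))

  0≤staying : ∀ (X Y : Vertex q) n {c} → 0ℚ ≤ c → ∀ v w → 0ℚ ≤ staying X Y n c v w
  0≤staying {q} X Y n 0≤c v w with does (related? n (dist v w) (dist Y v) (dist X w))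
  ... | true  = 0≤* 0≤c (0≤inv (q ^ dist v w))
  ... | false = ≤-refl

  module _ {d n} (X Y : Vertex q) (XY : dist X Y ≡ d) (d<n : d ℕ.< n) (1≤q : 1 ℕ.≤ q) (c : ℚ) where

    module _ {v} (v∈ : v ∈ sphere X n) where

      private
        R? : ∀ w → Dec (Related n (dist v w) (dist Y v) (dist X w))
        R? w = related? n (dist v w) (dist Y v) (dist X w)

        quad : ∀ {w} → w ∈ sphere Y n → Quadruple n d (dist v w) (dist Y v) (dist X w)
        quad {w} w∈ = quadruple X Y v w XY d<n (∈-sphere⁻ X v∈) (∈-sphere⁻ Y w∈)

        -- All related partners of `v` lie at one common distance `k`, so the weight is constant on
        -- them and the row sum is a count.
        row : ∀ {ws} k → Unique ws →
          (∀ {w} → w ∈ sphere Y n → Related n (dist v w) (dist Y v) (dist X w) → dist v w ≡ k × w ∈ ws) →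
          (∀ {w} → w ∈ ws → w ∈ sphere Y n × Related n (dist v w) (dist Y v) (dist X w)) →
          Σ[ sphere Y n ] (staying X Y n c v) ≡ ℕ→ℚ (length ws) * (c * inv (q ^ k))
        row {ws} k ws! to from = trans (Σ-cong (sphere Y n) weight) (trans (Σ-indicator R? (sphere Y n) (c * inv (q ^ k)))
          (cong (λ l → ℕ→ℚ l * (c * inv (q ^ k))) (unique-length (Unique.filter⁺ R? (sphere-unique Y n)) ws!
            (λ w∈ → let w∈S , r = ∈-filter⁻ R? {xs = sphere Y n} w∈ in proj₂ (to w∈S r))
            (λ w∈ → let w∈S , r = from w∈ in ∈-filter⁺ R? w∈S r))))
          where
          weight : ∀ {w} → w ∈ sphere Y n → staying X Y n c v w ≡ (if does (R? w) then c * inv (q ^ k) else 0ℚ)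
          weight {w} w∈ = if-cong (R? w) (λ r → cong (λ j → c * inv (q ^ j)) (proj₁ (to w∈ r)))

      -- The only partner is the point at distance `n` from `Y` on the geodesic to `v`. A share of
      -- the mass at `v` is left over when k > 0.
      row-≥ : ∀ k → dist Y v ≡ n ℕ.+ k → Σ[ sphere Y n ] (staying X Y n c v) ≡ c * inv (q ^ k)
      row-≥ k Yv with between n k Y v Yv
      ... | w₀ , Yw₀ , w₀v = trans (row {w₀ ∷ []} k (All.[] ∷ []) to from) (*-identityˡ _)
        where
        k+n : k ℕ.+ n ≡ dist Y v
        k+n = trans (ℕ.+-comm k n) (sym Yv)
        to : ∀ {w} → w ∈ sphere Y n → Related n (dist v w) (dist Y v) (dist X w) → dist v w ≡ k × w ∈ w₀ ∷ []
        to {w} w∈ r = vw , here (between-unique Y v w w₀ Yv (∈-sphere⁻ Y w∈) (trans (dist-sym w v) vw) Yw₀ w₀v)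
          where
          vw : dist v w ≡ k
          vw = ℕ.+-cancelʳ-≡ n (dist v w) k (trans (related-≥ (quad w∈) r (subst (n ℕ.≤_) (sym Yv) (ℕ.m≤m+n n k))) (sym k+n))
        from : ∀ {w} → w ∈ w₀ ∷ [] → w ∈ sphere Y n × Related n (dist v w) (dist Y v) (dist X w)
        from (here refl) = ∈-sphere⁺ Y w₀ Yw₀ , inj₁ (trans (cong (ℕ._+ n) (trans (dist-sym v w₀) w₀v)) k+n)

      -- The partners are the q^k descendants of `v` away from `Y` at k = n - dist Y v; each gets
      -- the share q^(-k), so all mass at `v` is used.
      row-≤ : dist Y v ℕ.≤ n → Σ[ sphere Y n ] (staying X Y n c v) ≡ c
      row-≤ b≤n = trans (row {descendants Y v k} k (descendants-unique Y v k) to from)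
        (trans (cong (λ l → ℕ→ℚ l * (c * inv (q ^ k))) (descendants-length Y v Y≢v k))
        (trans (solve 3 (λ l c i → l :* (c :* i) := c :* (l :* i)) refl (ℕ→ℚ (q ^ k)) c (inv (q ^ k)))
        (trans (cong (c *_) (ℕ→ℚ*inv (q ^ k) (ℕ.m^n>0 q ⦃ ℕ.>-nonZero 1≤q ⦄ k))) (*-identityʳ c))))
        where
        open +-*-Solver
        k : ℕ
        k = n ℕ.∸ dist Y v
        k+b : k ℕ.+ dist Y v ≡ n
        k+b = ℕ.m∸n+n≡m b≤n
        Y≢v : Y ≢ v
        Y≢v refl = ℕ.<⇒≢ d<n (trans (sym XY) (∈-sphere⁻ X v∈))
        to : ∀ {w} → w ∈ sphere Y n → Related n (dist v w) (dist Y v) (dist X w) → dist v w ≡ k × w ∈ descendants Y v k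
        to {w} w∈ r = vw , ∈-descendants⁺ Y v k vw (trans (∈-sphere⁻ Y w∈) (trans (sym k+b) (ℕ.+-comm k (dist Y v))))
          where
          vw : dist v w ≡ k
          vw = ℕ.+-cancelʳ-≡ (dist Y v) (dist v w) k (trans (related-≤ (quad w∈) r b≤n) (sym k+b))
        from : ∀ {w} → w ∈ descendants Y v k → w ∈ sphere Y n × Related n (dist v w) (dist Y v) (dist X w)
        from {w} w∈ with ∈-descendants⁻ Y v k w∈
        ... | vw , Yw = w∈S , inj₂ (completes (quad w∈S) (trans (cong (ℕ._+ dist Y v) vw) k+b))
          where
          w∈S : w ∈ sphere Y n
          w∈S = ∈-sphere⁺ Y w (trans Yw (trans (ℕ.+-comm (dist Y v) k) k+b))

      row≤ : 0ℚ ≤ c → Σ[ sphere Y n ] (staying X Y n c v) ≤ c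
      row≤ 0≤c with ℕ.≤-total (dist Y v) n
      ... | inj₁ b≤n = ≤-reflexive (row-≤ b≤n)
      ... | inj₂ n≤b = begin
        Σ[ sphere Y n ] (staying X Y n c v)  ≡⟨ row-≥ k (sym (ℕ.m+[n∸m]≡n n≤b)) ⟩
        c * inv (q ^ k)                      ≤⟨ *-monoˡ-≤-nonNeg c ⦃ nonNegative 0≤c ⦄ (inv≤1 (q ^ k)) ⟩
        c * 1ℚ                               ≡⟨ *-identityʳ c ⟩
        c                                    ∎
        where
        open ≤-Reasoning
        k : ℕ
        k = dist Y v ℕ.∸ n
        inv≤1 : ∀ m → inv m ≤ 1ℚ
        inv≤1 zero    = ℕ→ℚ-mono {0} {1} ℕ.z≤n
        inv≤1 (suc m) = begin
          inv (suc m)                 ≡⟨ *-identityˡ _ ⟨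
          1ℚ * inv (suc m)            ≤⟨ *-monoʳ-≤-nonNeg (inv (suc m)) ⦃ nonNegative (0≤inv (suc m)) ⦄ (ℕ→ℚ-mono {1} {suc m} (ℕ.s≤s ℕ.z≤n)) ⟩
          ℕ→ℚ (suc m) * inv (suc m)   ≡⟨ ℕ→ℚ*inv (suc m) (ℕ.s≤s ℕ.z≤n) ⟩
          1ℚ                          ∎

  -- Equality of primal and dual values

  module Transport {d m} (X Y : Vertex q) (XY : dist X Y ≡ d) (d≤m : d ℕ.≤ m) (1≤q : 1 ℕ.≤ q) where

    n N : ℕ
    n = suc m
    N = suc q ℕ.* q ^ m

    -- Undoes the affine change: the values are d/2 - n, 0 and b - d/2 for b < n, b = n and b > n.
    dual : ℕ → ℚ
    dual b = ½ * (ℕ→ℚ (potential n d b) - ℕ→ℚ (d ℕ.+ 2 ℕ.* n))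

    value : ℚ
    value = Σ[ sphere X n ] (λ v → dual (dist Y v) * mass (σ X n) v) + Σ[ sphere Y n ] (λ w → dual (dist X w) * mass (σ Y n) w)

    private
      quad : ∀ {v w} → v ∈ sphere X n → w ∈ sphere Y n → Quadruple n d (dist v w) (dist Y v) (dist X w)
      quad {v} {w} v∈ w∈ = quadruple X Y v w XY (ℕ.s≤s d≤m) (∈-sphere⁻ X v∈) (∈-sphere⁻ Y w∈)

      dual-sum : ∀ b a → dual b + dual a ≡ ½ * ℕ→ℚ (potential n d b ℕ.+ potential n d a) - ℕ→ℚ (d ℕ.+ 2 ℕ.* n)
      dual-sum b a = trans
        (solve 3 (λ x y z → con ½ :* (x :- z) :+ con ½ :* (y :- z) := con ½ :* (x :+ y) :- z) refl
          (ℕ→ℚ (potential n d b)) (ℕ→ℚ (potential n d a)) (ℕ→ℚ (d ℕ.+ 2 ℕ.* n)))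
        (cong (λ t → ½ * t - ℕ→ℚ (d ℕ.+ 2 ℕ.* n)) (sym (ℕ→ℚ-+ (potential n d b) (potential n d a))))
        where open +-*-Solver

      bound : ∀ D → ½ * ℕ→ℚ (2 ℕ.* D ℕ.+ (2 ℕ.* d ℕ.+ 4 ℕ.* n)) - ℕ→ℚ (d ℕ.+ 2 ℕ.* n) ≡ ℕ→ℚ D
      bound D = trans
        (cong (λ t → ½ * t - ℕ→ℚ (d ℕ.+ 2 ℕ.* n)) (trans (cong ℕ→ℚ (lemma D d n)) (trans (ℕ→ℚ-+ (D ℕ.+ D) _) (cong₂ _+_ (ℕ→ℚ-+ D D) (ℕ→ℚ-+ (d ℕ.+ 2 ℕ.* n) _)))))
        (solve 2 (λ x z → con ½ :* ((x :+ x) :+ (z :+ z)) :- z := x) refl (ℕ→ℚ D) (ℕ→ℚ (d ℕ.+ 2 ℕ.* n)))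
        where
        open +-*-Solver
        lemma : ∀ D d n → 2 ℕ.* D ℕ.+ (2 ℕ.* d ℕ.+ 4 ℕ.* n) ≡ (D ℕ.+ D) ℕ.+ ((d ℕ.+ 2 ℕ.* n) ℕ.+ (d ℕ.+ 2 ℕ.* n))
        lemma = solve-∀

      dual-≡ : ∀ {b a D} → potential n d b ℕ.+ potential n d a ≡ 2 ℕ.* D ℕ.+ (2 ℕ.* d ℕ.+ 4 ℕ.* n) → dual b + dual a ≡ ℕ→ℚ D
      dual-≡ {b} {a} {D} e = trans (dual-sum b a) (trans (cong (λ t → ½ * ℕ→ℚ t - ℕ→ℚ (d ℕ.+ 2 ℕ.* n)) e) (bound D))

      dual-≤ : ∀ {b a D} → potential n d b ℕ.+ potential n d a ℕ.≤ 2 ℕ.* D ℕ.+ (2 ℕ.* d ℕ.+ 4 ℕ.* n) → dual b + dual a ≤ ℕ→ℚ D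
      dual-≤ {b} {a} {D} le = subst₂ _≤_ (sym (dual-sum b a)) (bound D) (+-monoˡ-≤ (- ℕ→ℚ (d ℕ.+ 2 ℕ.* n)) (*-monoˡ-≤-nonNeg ½ (ℕ→ℚ-mono le)))

    lower : ≤W₁ value (σ X n) (σ Y n)
    lower π coupling = weak-duality (σ X n) (σ Y n) (λ v w → ℕ→ℚ (dist v w)) (λ v → dual (dist Y v)) (λ w → dual (dist X w))
      (λ {v} {w} v∈ w∈ → dual-≤ {dist Y v} {dist X w} {dist v w} (dominated (quad v∈ w∈))) coupling

    private
      c : ℚ
      c = inv N

      mass-X : inv (length (sphere X n)) ≡ c
      mass-X = cong inv (sphere-length X m)
      mass-Y : inv (length (sphere Y n)) ≡ c
      mass-Y = cong inv (sphere-length Y m)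

      YX : dist Y X ≡ d
      YX = trans (dist-sym Y X) XY

      column : ∀ w → Σ[ sphere X n ] (λ v → staying X Y n c v w) ≡ Σ[ sphere X n ] (staying Y X n c w)
      column w = Σ-cong (sphere X n) (λ {v} _ → staying-swap X Y n c v w)

      0≤c : 0ℚ ≤ c
      0≤c = 0≤inv N

      total : ∀ (x : Vertex q) → Σ[ sphere x n ] (λ _ → inv (length (sphere x n))) ≡ ℕ→ℚ N * inv N
      total x = trans (Σ-const (sphere x n) _) (cong (λ l → ℕ→ℚ l * inv l) (sphere-length x m))

      rows≤ : ∀ {v} → v ∈ sphere X n → Σ[ sphere Y n ] (λ w → staying X Y n c v w) ≤ mass (σ X n) v
      rows≤ v∈ = ≤-trans (row≤ X Y XY (ℕ.s≤s d≤m) 1≤q c v∈ 0≤c) (≤-reflexive (sym mass-X))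

      columns≤ : ∀ {w} → w ∈ sphere Y n → Σ[ sphere X n ] (λ v → staying X Y n c v w) ≤ mass (σ Y n) w
      columns≤ {w} w∈ = ≤-trans (≤-reflexive (column w))
        (≤-trans (row≤ Y X YX (ℕ.s≤s d≤m) 1≤q c w∈ 0≤c) (≤-reflexive (sym mass-Y)))

      open Completion (σ X n) (σ Y n) (staying X Y n c) (0≤staying X Y n 0≤c) rows≤ columns≤ (trans (total X) (sym (total Y)))

      excessˡ-0 : ∀ {v} → v ∈ sphere X n → dist Y v ℕ.≤ n → excessˡ v ≡ 0ℚ
      excessˡ-0 {v} v∈ b≤n = trans (cong₂ _-_ mass-X (row-≤ X Y XY (ℕ.s≤s d≤m) 1≤q c v∈ b≤n)) (+-inverseʳ c)

      excessʳ-0 : ∀ {w} → w ∈ sphere Y n → dist X w ℕ.≤ n → excessʳ w ≡ 0ℚ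
      excessʳ-0 {w} w∈ a≤n = trans (cong₂ _-_ mass-Y (trans (column w) (row-≤ Y X YX (ℕ.s≤s d≤m) 1≤q c w∈ a≤n))) (+-inverseʳ c)

      slack-staying : ∀ {v w} → v ∈ sphere X n → w ∈ sphere Y n →
        ℕ→ℚ (dist v w) * staying X Y n c v w ≡ (dual (dist Y v) + dual (dist X w)) * staying X Y n c v w
      slack-staying {v} {w} v∈ w∈ = supported (related? n (dist v w) (dist Y v) (dist X w)) (ℕ→ℚ (dist v w)) (dual (dist Y v) + dual (dist X w)) (c * inv (q ^ dist v w))
        (λ r → cong (_* (c * inv (q ^ dist v w))) (sym (dual-≡ {dist Y v} {dist X w} {dist v w} (tight-related (quad v∈ w∈) r))))
        where
        supported : ∀ {P : Set} (P? : Dec P) (x y z : ℚ) → (P → x * z ≡ y * z) →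
          x * (if does P? then z else 0ℚ) ≡ y * (if does P? then z else 0ℚ)
        supported (yes p) x y z e = e p
        supported (no _)  x y z e = trans (*-zeroʳ x) (sym (*-zeroʳ y))

      -- By `row-≤`, excess survives only where b > n and a > n, and there `tight->` holds for every
      -- pair.
      slack-excess : ∀ {v w} → v ∈ sphere X n → w ∈ sphere Y n →
        excessˡ v ≡ 0ℚ ⊎ excessʳ w ≡ 0ℚ ⊎ ℕ→ℚ (dist v w) ≡ dual (dist Y v) + dual (dist X w)
      slack-excess {v} {w} v∈ w∈ = go (dist Y v ℕ.≤? n) (dist X w ℕ.≤? n)
        where
        go : Dec (dist Y v ℕ.≤ n) → Dec (dist X w ℕ.≤ n) → excessˡ v ≡ 0ℚ ⊎ excessʳ w ≡ 0ℚ ⊎ ℕ→ℚ (dist v w) ≡ dual (dist Y v) + dual (dist X w)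
        go (yes b≤n) _         = inj₁ (excessˡ-0 v∈ b≤n)
        go (no _)    (yes a≤n) = inj₂ (inj₁ (excessʳ-0 w∈ a≤n))
        go (no b≰n)  (no a≰n)  = inj₂ (inj₂ (sym (dual-≡ {dist Y v} {dist X w} {dist v w} (tight-> (quad v∈ w∈) (ℕ.≰⇒> b≰n) (ℕ.≰⇒> a≰n)))))

    upper : W₁≤ (σ X n) (σ Y n) value
    upper = let π , coupling , cost≡ = strong-duality (λ v w → ℕ→ℚ (dist v w)) (λ v → dual (dist Y v)) (λ w → dual (dist X w)) slack-staying slack-excess
            in π , coupling , ≤-reflexive cost≡

  -- Layer-cake summation of the potential

  ind : ∀ {P : Set} → Dec P → ℕ
  ind P? = if does P? then 1 else 0

  -- With s = n + d and b + 2i = s, this is the indicator of j ≤ i, where i counts the edges shared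
  -- by the geodesics from `X` to `v` and to `Y`. Layers start at j = 1, so `tails` is the minimum
  -- of i and K.
  tail : (s b j : ℕ) → ℕ
  tail s b j = ind (b ℕ.+ 2 ℕ.* j ℕ.≤? s)

  tails : (s b K : ℕ) → ℕ
  tails s b zero    = 0
  tails s b (suc K) = tails s b K ℕ.+ tail s b (suc K)

  module _ (b : ℕ) {s i} (e : b ℕ.+ 2 ℕ.* i ≡ s) where

    tail-≤ : ∀ {j} → j ℕ.≤ i → tail s b j ≡ 1
    tail-≤ {j} j≤i = cong (if_then 1 else 0) (dec-true (b ℕ.+ 2 ℕ.* j ℕ.≤? s)
      (subst (b ℕ.+ 2 ℕ.* j ℕ.≤_) e (ℕ.+-monoʳ-≤ b (ℕ.*-monoʳ-≤ 2 j≤i))))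

    tail-> : ∀ {j} → i ℕ.< j → tail s b j ≡ 0
    tail-> {j} i<j = cong (if_then 1 else 0) (dec-false (b ℕ.+ 2 ℕ.* j ℕ.≤? s)
      (ℕ.<⇒≱ (subst (ℕ._< b ℕ.+ 2 ℕ.* j) e (ℕ.+-monoʳ-< b (ℕ.*-monoʳ-< 2 i<j)))))

    tails-≤ : ∀ K → K ℕ.≤ i → tails s b K ≡ K
    tails-≤ zero    _   = refl
    tails-≤ (suc K) K<i = trans (cong₂ ℕ._+_ (tails-≤ K (ℕ.<⇒≤ K<i)) (tail-≤ K<i)) (ℕ.+-comm K 1)

    tails-≥ : ∀ K → i ℕ.≤ K → tails s b K ≡ i
    tails-≥ zero z≤n = refl
    tails-≥ (suc K) i≤ with ℕ.m≤n⇒m<n∨m≡n i≤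
    ... | inj₂ refl      = tails-≤ (suc K) ℕ.≤-refl
    ... | inj₁ (s≤s i≤K) = trans (cong₂ ℕ._+_ (tails-≥ K i≤K) (tail-> (s≤s i≤K))) (ℕ.+-identityʳ i)

  -- Layer-cake form of the potential: δ = ⌊d/2⌋ and suc K = ⌈d/2⌉.
  module _ {n δ K : ℕ} (K≤δ : K ℕ.≤ δ) (δ≤ : δ ℕ.≤ suc K) where

    private
      d : ℕ
      d = δ ℕ.+ suc K

      assemble : ∀ {p p′ t t′ x x′ y y′ z} g₁ g₂ → p ≡ p′ → t ≡ t′ → x ≡ x′ → y ≡ y′ →
        p′ ℕ.+ 4 ℕ.* t′ ℕ.+ g₁ ℕ.* x′ ℕ.+ g₂ ℕ.* y′ ≡ z → p ℕ.+ 4 ℕ.* t ℕ.+ g₁ ℕ.* x ℕ.+ g₂ ℕ.* y ≡ z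
      assemble g₁ g₂ refl refl refl refl e = e

    -- Since b = n + d - 2i, each of the first K shared edges lowers 2b + 2n by 4. `g₁` is the drop
    -- from the value at i = K to d + 2n, the value at b = n, and `g₂` the drop from there to 2d.
    -- For odd d both drops occur at the same edge.
    layers : ∀ {b i g₁ g₂} → b ℕ.+ 2 ℕ.* i ≡ n ℕ.+ d → g₁ ℕ.+ 4 ℕ.* K ≡ 2 ℕ.* n ℕ.+ d → g₂ ℕ.+ d ≡ 2 ℕ.* n →
      potential n d b ℕ.+ 4 ℕ.* tails (n ℕ.+ d) b K ℕ.+ g₁ ℕ.* tail (n ℕ.+ d) b (suc K) ℕ.+ g₂ ℕ.* tail (n ℕ.+ d) b (suc δ)
        ≡ 4 ℕ.* n ℕ.+ 2 ℕ.* d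
    layers {b} {i} {g₁} {g₂} e e₁ e₂ with i ℕ.≤? K
    ... | yes i≤K = assemble g₁ g₂ (potential-> d n<b) (tails-≥ b e K i≤K) (tail-> b e (s≤s i≤K)) (tail-> b e (s≤s (ℕ.≤-trans i≤K K≤δ)))
        (trans (lemma₁ b n i g₁ g₂) (trans (cong (λ t → 2 ℕ.* t ℕ.+ 2 ℕ.* n) e) (lemma₂ n d)))
      where
      lemma₀ : ∀ n b i K δ → suc n ℕ.+ (b ℕ.+ 2 ℕ.* i ℕ.+ (K ℕ.+ δ)) ℕ.+ 0 ≡ b ℕ.+ (n ℕ.+ (δ ℕ.+ suc K) ℕ.+ (i ℕ.+ i))
      lemma₀ = solve-∀
      n<b : n ℕ.< b
      n<b = linear 0 (ℕ.+-mono-≤ (ℕ.≤-reflexive (sym e)) (ℕ.+-mono-≤ i≤K (ℕ.≤-trans i≤K K≤δ))) (lemma₀ n b i K δ)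
      lemma₁ : ∀ b n i g₁ g₂ → 2 ℕ.* b ℕ.+ 2 ℕ.* n ℕ.+ 4 ℕ.* i ℕ.+ g₁ ℕ.* 0 ℕ.+ g₂ ℕ.* 0 ≡ 2 ℕ.* (b ℕ.+ 2 ℕ.* i) ℕ.+ 2 ℕ.* n
      lemma₁ = solve-∀
      lemma₂ : ∀ n d → 2 ℕ.* (n ℕ.+ d) ℕ.+ 2 ℕ.* n ≡ 4 ℕ.* n ℕ.+ 2 ℕ.* d
      lemma₂ = solve-∀
    ... | no i≰K with i ℕ.≤? δ
    ...   | yes i≤δ = assemble g₁ g₂ (potential-≡ d b≡n) (tails-≤ b e K (ℕ.<⇒≤ K<i)) (tail-≤ b e K<i) (tail-> b e (s≤s i≤δ))
        (trans (lemma₁ n d K g₁ g₂) (trans (cong (d ℕ.+ 2 ℕ.* n ℕ.+_) e₁) (lemma₂ n d)))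
      where
      K<i : K ℕ.< i
      K<i = ℕ.≰⇒> i≰K
      -- K < i ≤ δ forces i = δ = K + 1: this case occurs only for even d, at b = n.
      2i≡d : i ℕ.+ i ≡ d
      2i≡d = cong₂ ℕ._+_ (ℕ.≤-antisym i≤δ (ℕ.≤-trans δ≤ K<i)) (ℕ.≤-antisym (ℕ.≤-trans i≤δ δ≤) K<i)
      lemma₀ : ∀ b i → b ℕ.+ (i ℕ.+ i) ≡ b ℕ.+ 2 ℕ.* i
      lemma₀ = solve-∀
      b≡n : b ≡ n
      b≡n = ℕ.+-cancelʳ-≡ d b n (trans (cong (b ℕ.+_) (sym 2i≡d)) (trans (lemma₀ b i) e))
      lemma₁ : ∀ n d K g₁ g₂ → d ℕ.+ 2 ℕ.* n ℕ.+ 4 ℕ.* K ℕ.+ g₁ ℕ.* 1 ℕ.+ g₂ ℕ.* 0 ≡ d ℕ.+ 2 ℕ.* n ℕ.+ (g₁ ℕ.+ 4 ℕ.* K)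
      lemma₁ = solve-∀
      lemma₂ : ∀ n d → d ℕ.+ 2 ℕ.* n ℕ.+ (2 ℕ.* n ℕ.+ d) ≡ 4 ℕ.* n ℕ.+ 2 ℕ.* d
      lemma₂ = solve-∀
    ...   | no i≰δ = assemble g₁ g₂ (potential-< d b<n) (tails-≤ b e K (ℕ.<⇒≤ K<i)) (tail-≤ b e K<i) (tail-≤ b e (ℕ.≰⇒> i≰δ))
        (trans (lemma₁ d K g₁ g₂) (trans (cong₂ (λ x y → d ℕ.+ (x ℕ.+ y)) e₁ e₂) (lemma₂ n d)))
      where
      K<i : K ℕ.< i
      K<i = ℕ.≰⇒> i≰K
      lemma₀ : ∀ n b i K δ → suc b ℕ.+ (n ℕ.+ (δ ℕ.+ suc K) ℕ.+ (i ℕ.+ i)) ℕ.+ 0 ≡ n ℕ.+ (b ℕ.+ 2 ℕ.* i ℕ.+ (suc K ℕ.+ suc δ))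
      lemma₀ = solve-∀
      b<n : b ℕ.< n
      b<n = linear 0 (ℕ.+-mono-≤ (ℕ.≤-reflexive e) (ℕ.+-mono-≤ K<i (ℕ.≰⇒> i≰δ))) (lemma₀ n b i K δ)
      lemma₁ : ∀ d K g₁ g₂ → 2 ℕ.* d ℕ.+ 4 ℕ.* K ℕ.+ g₁ ℕ.* 1 ℕ.+ g₂ ℕ.* 1 ≡ d ℕ.+ (g₁ ℕ.+ 4 ℕ.* K ℕ.+ (g₂ ℕ.+ d))
      lemma₁ = solve-∀
      lemma₂ : ∀ n d → d ℕ.+ (2 ℕ.* n ℕ.+ d ℕ.+ 2 ℕ.* n) ≡ 4 ℕ.* n ℕ.+ 2 ℕ.* d
      lemma₂ = solve-∀

  geometric : (q n K : ℕ) → ℕ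
  geometric q n zero    = 0
  geometric q n (suc K) = geometric q n K ℕ.+ q ^ (n ℕ.∸ suc K)

  -- The telescoped sum of q^(n-j) for j from 1 to K, stated without division by q - 1 and without
  -- subtraction.
  geometric-sum : ∀ q n K → K ℕ.≤ n → q ℕ.* geometric q n K ℕ.+ q ^ (n ℕ.∸ K) ≡ geometric q n K ℕ.+ q ^ n
  geometric-sum q n zero _ = cong (ℕ._+ q ^ n) (ℕ.*-zeroʳ q)
  geometric-sum q n (suc K) K<n = trans (lemma₁ q (geometric q n K) (q ^ (n ℕ.∸ suc K)))
    (trans (cong (λ t → q ℕ.* geometric q n K ℕ.+ t ℕ.+ q ^ (n ℕ.∸ suc K)) power)
    (trans (cong (ℕ._+ q ^ (n ℕ.∸ suc K)) (geometric-sum q n K (ℕ.<⇒≤ K<n))) (lemma₂ (geometric q n K) (q ^ n) (q ^ (n ℕ.∸ suc K)))))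
    where
    power : q ℕ.* q ^ (n ℕ.∸ suc K) ≡ q ^ (n ℕ.∸ K)
    power = cong (q ^_) (sym (ℕ.+-∸-assoc 1 K<n))
    lemma₁ : ∀ q g p → q ℕ.* (g ℕ.+ p) ℕ.+ p ≡ q ℕ.* g ℕ.+ q ℕ.* p ℕ.+ p
    lemma₁ = solve-∀
    lemma₂ : ∀ g r p → g ℕ.+ r ℕ.+ p ≡ g ℕ.+ p ℕ.+ r
    lemma₂ = solve-∀

  module _ (X Y : Vertex q) {n δ K : ℕ} (K≤δ : K ℕ.≤ δ) (δ≤ : δ ℕ.≤ suc K)
    (XY : dist X Y ≡ δ ℕ.+ suc K) (d<n : δ ℕ.+ suc K ℕ.< n) where

    private
      d s : ℕ
      d = δ ℕ.+ suc K
      s = n ℕ.+ d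
      S = sphere X n

    Σ-tail : ∀ j m → 1 ℕ.≤ j → j ℕ.≤ d → j ℕ.+ m ≡ n → Σ[ S ] (λ v → ℕ→ℚ (tail s (dist Y v) j)) ≡ ℕ→ℚ (q ^ m)
    Σ-tail j m 1≤j j≤d jm = trans (Σ-cong S (λ {v} _ → if-ℕ→ℚ (does (dist Y v ℕ.+ 2 ℕ.* j ℕ.≤? s))))
      (trans (Σ-indicator (λ v → dist Y v ℕ.+ 2 ℕ.* j ℕ.≤? s) S 1ℚ)
      (trans (*-identityʳ _) (cong ℕ→ℚ (sphere-tail X Y j m XY 1≤j j≤d jm))))
      where
      if-ℕ→ℚ : ∀ b → ℕ→ℚ (if b then 1 else 0) ≡ (if b then 1ℚ else 0ℚ)
      if-ℕ→ℚ true  = refl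
      if-ℕ→ℚ false = refl

    Σ-tails : ∀ J → J ℕ.≤ K → Σ[ S ] (λ v → ℕ→ℚ (tails s (dist Y v) J)) ≡ ℕ→ℚ (geometric q n J)
    Σ-tails zero _ = Σ-0 S
    Σ-tails (suc J) J<K = trans (Σ-cong S (λ {v} _ → ℕ→ℚ-+ (tails s (dist Y v) J) (tail s (dist Y v) (suc J))))
      (trans (Σ-+ S (λ v → ℕ→ℚ (tails s (dist Y v) J)) (λ v → ℕ→ℚ (tail s (dist Y v) (suc J))))
      (trans (cong₂ _+_ (Σ-tails J (ℕ.<⇒≤ J<K)) (Σ-tail (suc J) (n ℕ.∸ suc J) (s≤s z≤n) J≤d (ℕ.m+[n∸m]≡n (ℕ.≤-trans J≤d (ℕ.<⇒≤ d<n)))))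
      (sym (ℕ→ℚ-+ (geometric q n J) (q ^ (n ℕ.∸ suc J))))))
      where
      J≤d : suc J ℕ.≤ d
      J≤d = ℕ.≤-trans (ℕ.≤-trans J<K (ℕ.n≤1+n K)) (ℕ.m≤n+m (suc K) δ)

    -- `layers` summed over the sphere, each layer being counted by `sphere-tail`. The correction
    -- terms stay on the left so that no natural number is subtracted.
    Σ-potential : ∀ {g₁ g₂ m₁ m₂} → g₁ ℕ.+ 4 ℕ.* K ≡ 2 ℕ.* n ℕ.+ d → g₂ ℕ.+ d ≡ 2 ℕ.* n → suc K ℕ.+ m₁ ≡ n → suc δ ℕ.+ m₂ ≡ n →
      Σ[ S ] (λ v → ℕ→ℚ (potential n d (dist Y v))) + ℕ→ℚ 4 * ℕ→ℚ (geometric q n K) + ℕ→ℚ g₁ * ℕ→ℚ (q ^ m₁) + ℕ→ℚ g₂ * ℕ→ℚ (q ^ m₂)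
        ≡ ℕ→ℚ (length S) * ℕ→ℚ (4 ℕ.* n ℕ.+ 2 ℕ.* d)
    Σ-potential {g₁} {g₂} {m₁} {m₂} e₁ e₂ e₃ e₄ = begin
      Σ[ S ] f₀ + ℕ→ℚ 4 * ℕ→ℚ (geometric q n K) + ℕ→ℚ g₁ * ℕ→ℚ (q ^ m₁) + ℕ→ℚ g₂ * ℕ→ℚ (q ^ m₂)
        ≡⟨ cong₂ _+_ (cong₂ _+_ (cong (λ t → Σ[ S ] f₀ + ℕ→ℚ 4 * t) (Σ-tails K ℕ.≤-refl))
            (cong (ℕ→ℚ g₁ *_) (Σ-tail (suc K) m₁ (s≤s z≤n) (ℕ.m≤n+m (suc K) δ) e₃)))
            (cong (ℕ→ℚ g₂ *_) (Σ-tail (suc δ) m₂ (s≤s z≤n) (subst (suc δ ℕ.≤_) (sym (ℕ.+-suc δ K)) (s≤s (ℕ.m≤m+n δ K))) e₄)) ⟨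
      Σ[ S ] f₀ + ℕ→ℚ 4 * Σ[ S ] f₁ + ℕ→ℚ g₁ * Σ[ S ] f₂ + ℕ→ℚ g₂ * Σ[ S ] f₃
        ≡⟨ cong₂ _+_ (cong₂ _+_ (cong (Σ[ S ] f₀ +_) (Σ-* S (ℕ→ℚ 4) f₁)) (Σ-* S (ℕ→ℚ g₁) f₂)) (Σ-* S (ℕ→ℚ g₂) f₃) ⟨
      Σ[ S ] f₀ + Σ[ S ] h₁ + Σ[ S ] h₂ + Σ[ S ] h₃
        ≡⟨ trans (Σ-+ S (λ v → f₀ v + h₁ v + h₂ v) h₃) (cong (_+ Σ[ S ] h₃)
            (trans (Σ-+ S (λ v → f₀ v + h₁ v) h₂) (cong (_+ Σ[ S ] h₂) (Σ-+ S f₀ h₁)))) ⟨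
      Σ[ S ] (λ v → f₀ v + h₁ v + h₂ v + h₃ v)
        ≡⟨ Σ-cong S pointwise ⟩
      Σ[ S ] (λ _ → ℕ→ℚ (4 ℕ.* n ℕ.+ 2 ℕ.* d))
        ≡⟨ Σ-const S _ ⟩
      ℕ→ℚ (length S) * ℕ→ℚ (4 ℕ.* n ℕ.+ 2 ℕ.* d) ∎
      where
      open ≡-Reasoning
      f₀ f₁ f₂ f₃ h₁ h₂ h₃ : Vertex q → ℚ
      f₀ v = ℕ→ℚ (potential n d (dist Y v))
      f₁ v = ℕ→ℚ (tails s (dist Y v) K)
      f₂ v = ℕ→ℚ (tail s (dist Y v) (suc K))
      f₃ v = ℕ→ℚ (tail s (dist Y v) (suc δ))
      h₁ v = ℕ→ℚ 4 * f₁ v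
      h₂ v = ℕ→ℚ g₁ * f₂ v
      h₃ v = ℕ→ℚ g₂ * f₃ v
      cast : ∀ p t x y → ℕ→ℚ p + ℕ→ℚ 4 * ℕ→ℚ t + ℕ→ℚ g₁ * ℕ→ℚ x + ℕ→ℚ g₂ * ℕ→ℚ y ≡ ℕ→ℚ (p ℕ.+ 4 ℕ.* t ℕ.+ g₁ ℕ.* x ℕ.+ g₂ ℕ.* y)
      cast p t x y = sym (trans (ℕ→ℚ-+ (p ℕ.+ 4 ℕ.* t ℕ.+ g₁ ℕ.* x) (g₂ ℕ.* y)) (cong₂ _+_
        (trans (ℕ→ℚ-+ (p ℕ.+ 4 ℕ.* t) (g₁ ℕ.* x)) (cong₂ _+_ (trans (ℕ→ℚ-+ p (4 ℕ.* t)) (cong (ℕ→ℚ p +_) (ℕ→ℚ-* 4 t))) (ℕ→ℚ-* g₁ x))) (ℕ→ℚ-* g₂ y)))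
      pointwise : ∀ {v} → v ∈ S → f₀ v + h₁ v + h₂ v + h₃ v ≡ ℕ→ℚ (4 ℕ.* n ℕ.+ 2 ℕ.* d)
      pointwise {v} v∈ = let i , e = dist-parity X Y v in trans (cast (potential n d (dist Y v)) (tails s (dist Y v) K) (tail s (dist Y v) (suc K)) (tail s (dist Y v) (suc δ)))
        (cong ℕ→ℚ (layers K≤δ δ≤ {dist Y v} {i} {g₁} {g₂} (trans e (cong₂ ℕ._+_ (∈-sphere⁻ X v∈) XY)) e₁ e₂))

  -- Evaluation of the closed form

  2ℚ 4ℚ : ℚ
  2ℚ = 1ℚ + 1ℚ
  4ℚ = 2ℚ + 2ℚ

  -- P, M₁, M₂, U, W stand for q^(n-1), q^(n-δ'), q^(n-1-δ), q^δ', q^δ with δ' = κ + 1;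
  -- u, w, t, s, c are the inverses of U, W, q + 1, q² - 1 and of the number of points of the sphere.
  module Evaluation {Q n δ κ P M₁ M₂ U W u w t s c : ℚ}
    (hN : (1ℚ + Q) * P * c ≡ 1ℚ) (hu : U * u ≡ 1ℚ) (hw : W * w ≡ 1ℚ) (ht : (Q + 1ℚ) * t ≡ 1ℚ) (hs : (Q * Q - 1ℚ) * s ≡ 1ℚ)
    (hM₁ : M₁ * U ≡ Q * P) (hM₂ : M₂ * W ≡ P) where

    open ≡-Reasoning
    open +-*-Solver

    private
      d : ℚ
      d = δ + (1ℚ + κ)

      Pc : P * c ≡ t
      Pc = begin
        P * c                        ≡⟨ *-identityʳ (P * c) ⟨
        P * c * 1ℚ                   ≡⟨ cong (P * c *_) ht ⟨
        P * c * ((Q + 1ℚ) * t)       ≡⟨ solve 4 (λ P c Q t → P :* c :* ((Q :+ con 1ℚ) :* t) := (con 1ℚ :+ Q) :* P :* c :* t) refl P c Q t ⟩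
        (1ℚ + Q) * P * c * t         ≡⟨ cong (_* t) hN ⟩
        1ℚ * t                       ≡⟨ *-identityˡ t ⟩
        t                            ∎

      M₁c : M₁ * c ≡ Q * t * u
      M₁c = begin
        M₁ * c                 ≡⟨ *-identityʳ (M₁ * c) ⟨
        M₁ * c * 1ℚ            ≡⟨ cong (M₁ * c *_) hu ⟨
        M₁ * c * (U * u)       ≡⟨ solve 4 (λ M c U u → M :* c :* (U :* u) := M :* U :* c :* u) refl M₁ c U u ⟩
        M₁ * U * c * u         ≡⟨ cong (λ x → x * c * u) hM₁ ⟩
        Q * P * c * u          ≡⟨ cong (_* u) (*-assoc Q P c) ⟩
        Q * (P * c) * u        ≡⟨ cong (λ x → Q * x * u) Pc ⟩
        Q * t * u              ∎

      M₂c : M₂ * c ≡ t * w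
      M₂c = begin
        M₂ * c                 ≡⟨ *-identityʳ (M₂ * c) ⟨
        M₂ * c * 1ℚ            ≡⟨ cong (M₂ * c *_) hw ⟨
        M₂ * c * (W * w)       ≡⟨ solve 4 (λ M c U u → M :* c :* (U :* u) := M :* U :* c :* u) refl M₂ c W w ⟩
        M₂ * W * c * w         ≡⟨ cong (λ x → x * c * w) hM₂ ⟩
        P * c * w              ≡⟨ cong (_* w) Pc ⟩
        t * w                  ∎

      -- Since Q² - 1 = (Q + 1)(Q - 1), the inverse of Q + 1 can be expressed by `s`, and only one
      -- of these two inverses remains.
      t≡ : t ≡ s * (Q - 1ℚ)
      t≡ = begin
        t                                ≡⟨ *-identityʳ t ⟨
        t * 1ℚ                           ≡⟨ cong (t *_) hs ⟨
        t * ((Q * Q - 1ℚ) * s)           ≡⟨ solve 3 (λ t Q s → t :* ((Q :* Q :- con 1ℚ) :* s) := (Q :+ con 1ℚ) :* t :* (s :* (Q :- con 1ℚ))) refl t Q s ⟩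
        (Q + 1ℚ) * t * (s * (Q - 1ℚ))    ≡⟨ cong (_* (s * (Q - 1ℚ))) ht ⟩
        1ℚ * (s * (Q - 1ℚ))              ≡⟨ *-identityˡ _ ⟩
        s * (Q - 1ℚ)                     ∎

    module _ {S geo g₁ g₂ : ℚ}
      (hS : S + 4ℚ * geo + g₁ * M₁ + g₂ * M₂ ≡ (1ℚ + Q) * P * (4ℚ * n + 2ℚ * d))
      (hgeo : Q * geo + Q * M₁ ≡ geo + Q * P)
      (hg₁ : g₁ + 4ℚ * κ ≡ 2ℚ * n + d) (hg₂ : g₂ + d ≡ 2ℚ * n) where

      private
        -- After multiplication by (Q² - 1) s, the factor Q - 1 turns `geo` into Q (P - M₁) by
        -- `hgeo`, and the factor Q + 1 absorbs the `t` that comes from P c and M₁ c.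
        geo-c : geo * c ≡ s * Q * (1ℚ - Q * u)
        geo-c = begin
          geo * c                                                    ≡⟨ *-identityʳ (geo * c) ⟨
          geo * c * 1ℚ                                               ≡⟨ cong (geo * c *_) hs ⟨
          geo * c * ((Q * Q - 1ℚ) * s)                               ≡⟨ solve 5 (λ g c Q s M → g :* c :* ((Q :* Q :- con 1ℚ) :* s)
                                                                          := ((Q :* g :+ Q :* M) :- (g :+ Q :* M)) :* c :* (Q :+ con 1ℚ) :* s) refl geo c Q s M₁ ⟩
          ((Q * geo + Q * M₁) - (geo + Q * M₁)) * c * (Q + 1ℚ) * s   ≡⟨ cong (λ x → (x - (geo + Q * M₁)) * c * (Q + 1ℚ) * s) hgeo ⟩
          ((geo + Q * P) - (geo + Q * M₁)) * c * (Q + 1ℚ) * s        ≡⟨ solve 6 (λ g c Q s M P → ((g :+ Q :* P) :- (g :+ Q :* M)) :* c :* (Q :+ con 1ℚ) :* s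
                                                                          := Q :* (P :* c :- M :* c) :* (Q :+ con 1ℚ) :* s) refl geo c Q s M₁ P ⟩
          Q * (P * c - M₁ * c) * (Q + 1ℚ) * s                        ≡⟨ cong₂ (λ x y → Q * (x - y) * (Q + 1ℚ) * s) Pc M₁c ⟩
          Q * (t - Q * t * u) * (Q + 1ℚ) * s                         ≡⟨ solve 4 (λ Q t u s → Q :* (t :- Q :* t :* u) :* (Q :+ con 1ℚ) :* s
                                                                          := s :* Q :* (con 1ℚ :- Q :* u) :* ((Q :+ con 1ℚ) :* t)) refl Q t u s ⟩
          s * Q * (1ℚ - Q * u) * ((Q + 1ℚ) * t)                      ≡⟨ cong (s * Q * (1ℚ - Q * u) *_) ht ⟩
          s * Q * (1ℚ - Q * u) * 1ℚ                                  ≡⟨ *-identityʳ _ ⟩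
          s * Q * (1ℚ - Q * u)                                       ∎

        Sc : S * c ≡ (4ℚ * n + 2ℚ * d) - 4ℚ * (geo * c) - g₁ * (M₁ * c) - g₂ * (M₂ * c)
        Sc = begin
          S * c
            ≡⟨ solve 7 (λ S g M₁ M₂ g₁ g₂ c → S :* c
                 := (S :+ con 4ℚ :* g :+ g₁ :* M₁ :+ g₂ :* M₂) :* c :- con 4ℚ :* (g :* c) :- g₁ :* (M₁ :* c) :- g₂ :* (M₂ :* c)) refl S geo M₁ M₂ g₁ g₂ c ⟩
          (S + 4ℚ * geo + g₁ * M₁ + g₂ * M₂) * c - 4ℚ * (geo * c) - g₁ * (M₁ * c) - g₂ * (M₂ * c)
            ≡⟨ cong (λ x → x - 4ℚ * (geo * c) - g₁ * (M₁ * c) - g₂ * (M₂ * c)) (trans (cong (_* c) hS) scaled) ⟩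
          (4ℚ * n + 2ℚ * d) - 4ℚ * (geo * c) - g₁ * (M₁ * c) - g₂ * (M₂ * c) ∎
          where
          scaled : (1ℚ + Q) * P * (4ℚ * n + 2ℚ * d) * c ≡ 4ℚ * n + 2ℚ * d
          scaled = trans (solve 4 (λ Q P x c → (con 1ℚ :+ Q) :* P :* x :* c := (con 1ℚ :+ Q) :* P :* c :* x) refl Q P (4ℚ * n + 2ℚ * d) c)
            (trans (cong (_* (4ℚ * n + 2ℚ * d)) hN) (*-identityˡ _))

        g₁≡ : g₁ ≡ 2ℚ * n + d - 4ℚ * κ
        g₁≡ = trans (solve 2 (λ g k → g := g :+ con 4ℚ :* k :- con 4ℚ :* k) refl g₁ κ) (cong (_- 4ℚ * κ) hg₁)

        g₂≡ : g₂ ≡ 2ℚ * n - d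
        g₂≡ = trans (solve 2 (λ g d → g := g :+ d :- d) refl g₂ d) (cong (_- d) hg₂)

      -- With `S` the sum of the potential over one sphere, the left side is twice the dual integral
      -- over that sphere. All inverses except `s`, `u` and `w` are eliminated on the right.
      excess-value : S * c - (d + 2ℚ * n) ≡
        2ℚ * n * ((Q + 1ℚ) * (s * (Q - 1ℚ))) + d - 4ℚ * (s * Q * (1ℚ - Q * u)) - (2ℚ * n + d - 4ℚ * κ) * (Q * (s * (Q - 1ℚ)) * u) - (2ℚ * n - d) * (s * (Q - 1ℚ) * w)
      excess-value = begin
        S * c - (d + 2ℚ * n)
          ≡⟨ cong (_- (d + 2ℚ * n)) Sc ⟩
        (4ℚ * n + 2ℚ * d) - 4ℚ * (geo * c) - g₁ * (M₁ * c) - g₂ * (M₂ * c) - (d + 2ℚ * n)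
          -- The factor 1 is displayed in order to be replaced by (Q + 1) t, which gives the term
          -- linear in n the shape it has in the slope.
          ≡⟨ solve 5 (λ n d x y z → (con 4ℚ :* n :+ con 2ℚ :* d) :- x :- y :- z :- (d :+ con 2ℚ :* n) := con 2ℚ :* n :* con 1ℚ :+ d :- x :- y :- z)
               refl n d (4ℚ * (geo * c)) (g₁ * (M₁ * c)) (g₂ * (M₂ * c)) ⟩
        2ℚ * n * 1ℚ + d - 4ℚ * (geo * c) - g₁ * (M₁ * c) - g₂ * (M₂ * c)
          ≡⟨ cong₂ _-_ (cong₂ _-_ (cong₂ (λ x y → 2ℚ * n * x + d - 4ℚ * y) (sym ht) geo-c) (cong₂ _*_ g₁≡ M₁c)) (cong₂ _*_ g₂≡ M₂c) ⟩
        2ℚ * n * ((Q + 1ℚ) * t) + d - 4ℚ * (s * Q * (1ℚ - Q * u)) - (2ℚ * n + d - 4ℚ * κ) * (Q * t * u) - (2ℚ * n - d) * (t * w)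
          ≡⟨ cong (λ t → 2ℚ * n * ((Q + 1ℚ) * t) + d - 4ℚ * (s * Q * (1ℚ - Q * u)) - (2ℚ * n + d - 4ℚ * κ) * (Q * t * u) - (2ℚ * n - d) * (t * w)) t≡ ⟩
        2ℚ * n * ((Q + 1ℚ) * (s * (Q - 1ℚ))) + d - 4ℚ * (s * Q * (1ℚ - Q * u)) - (2ℚ * n + d - 4ℚ * κ) * (Q * (s * (Q - 1ℚ)) * u) - (2ℚ * n - d) * (s * (Q - 1ℚ) * w) ∎

      -- The parity of d expresses δ and `w` through κ and `u`. What remains is a polynomial
      -- identity in Q, n, κ, u, s, which a ring solver decides; the first case is odd d, the second
      -- even d.
      odd-or-even : (δ ≡ κ × w ≡ Q * u) ⊎ (δ ≡ 1ℚ + κ × w ≡ u) →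
        S * c - (d + 2ℚ * n) ≡ (2ℚ * ((Q + 1ℚ) - Q * u - w)) * t * n
          + (d + (- (4ℚ * Q) + 2ℚ * ((1ℚ + κ) * (Q - 1ℚ) + 1ℚ) * Q * u + 2ℚ * (δ * (Q - 1ℚ) + Q) * w) * s)
      odd-or-even (inj₁ (refl , refl)) = trans excess-value (trans
        (solve 5 (λ Q n κ u s → let d = κ :+ (con 1ℚ :+ κ) ; t = s :* (Q :- con 1ℚ) ; w = Q :* u in
          con 2ℚ :* n :* ((Q :+ con 1ℚ) :* t) :+ d :- con 4ℚ :* (s :* Q :* (con 1ℚ :- Q :* u)) :- (con 2ℚ :* n :+ d :- con 4ℚ :* κ) :* (Q :* t :* u) :- (con 2ℚ :* n :- d) :* (t :* w)
          := (con 2ℚ :* ((Q :+ con 1ℚ) :- Q :* u :- w)) :* t :* n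
            :+ (d :+ (:- (con 4ℚ :* Q) :+ con 2ℚ :* ((con 1ℚ :+ κ) :* (Q :- con 1ℚ) :+ con 1ℚ) :* Q :* u :+ con 2ℚ :* (κ :* (Q :- con 1ℚ) :+ Q) :* w) :* s))
          refl Q n κ u s)
        (cong (λ t → (2ℚ * ((Q + 1ℚ) - Q * u - w)) * t * n
          + (d + (- (4ℚ * Q) + 2ℚ * ((1ℚ + κ) * (Q - 1ℚ) + 1ℚ) * Q * u + 2ℚ * (δ * (Q - 1ℚ) + Q) * w) * s)) (sym t≡)))
      odd-or-even (inj₂ (refl , refl)) = trans excess-value (trans
        (solve 5 (λ Q n κ u s → let d = (con 1ℚ :+ κ) :+ (con 1ℚ :+ κ) ; t = s :* (Q :- con 1ℚ) ; w = u in
          con 2ℚ :* n :* ((Q :+ con 1ℚ) :* t) :+ d :- con 4ℚ :* (s :* Q :* (con 1ℚ :- Q :* u)) :- (con 2ℚ :* n :+ d :- con 4ℚ :* κ) :* (Q :* t :* u) :- (con 2ℚ :* n :- d) :* (t :* w)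
          := (con 2ℚ :* ((Q :+ con 1ℚ) :- Q :* u :- w)) :* t :* n
            :+ (d :+ (:- (con 4ℚ :* Q) :+ con 2ℚ :* ((con 1ℚ :+ κ) :* (Q :- con 1ℚ) :+ con 1ℚ) :* Q :* u :+ con 2ℚ :* ((con 1ℚ :+ κ) :* (Q :- con 1ℚ) :+ Q) :* w) :* s))
          refl Q n κ u s)
        (cong (λ t → (2ℚ * ((Q + 1ℚ) - Q * u - w)) * t * n
          + (d + (- (4ℚ * Q) + 2ℚ * ((1ℚ + κ) * (Q - 1ℚ) + 1ℚ) * Q * u + 2ℚ * (δ * (Q - 1ℚ) + Q) * w) * s)) (sym t≡)))

  inv-unique : ∀ {m} → 0 ℕ.< m → ∀ {x} → ℕ→ℚ m * x ≡ 1ℚ → x ≡ inv m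
  inv-unique {m} 0<m {x} e = begin
    x                       ≡⟨ *-identityʳ x ⟨
    x * 1ℚ                  ≡⟨ cong (x *_) (ℕ→ℚ*inv m 0<m) ⟨
    x * (ℕ→ℚ m * inv m)     ≡⟨ solve 3 (λ x m i → x :* (m :* i) := m :* x :* i) refl x (ℕ→ℚ m) (inv m) ⟩
    ℕ→ℚ m * x * inv m       ≡⟨ cong (_* inv m) e ⟩
    1ℚ * inv m              ≡⟨ *-identityˡ _ ⟩
    inv m                   ∎
    where
    open ≡-Reasoning
    open +-*-Solver

  ⌈n/2⌉≡⌊n/2⌋⊎1+ : ∀ n → ⌈ n /2⌉ ≡ ⌊ n /2⌋ ⊎ ⌈ n /2⌉ ≡ suc ⌊ n /2⌋
  ⌈n/2⌉≡⌊n/2⌋⊎1+ zero          = inj₁ refl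
  ⌈n/2⌉≡⌊n/2⌋⊎1+ (suc zero)    = inj₂ refl
  ⌈n/2⌉≡⌊n/2⌋⊎1+ (suc (suc n)) with ⌈n/2⌉≡⌊n/2⌋⊎1+ n
  ... | inj₁ e = inj₁ (cong suc e)
  ... | inj₂ e = inj₂ (cong suc e)

  -- Instantiation with the actual distances and powers of q

  module Value {q d′ m : ℕ} (2≤q : 2 ℕ.≤ q) (X Y : Vertex q) (XY : dist X Y ≡ suc d′) (d≤m : suc d′ ℕ.≤ m) where

    private
      1≤q : 1 ℕ.≤ q
      1≤q = ℕ.≤-trans (s≤s z≤n) 2≤q

      n K δ d g₁ g₂ m₁ m₂ : ℕ
      n = suc m
      -- With d = d′ + 1, the numbers `suc K` and `δ` are by computation the rounded-up and
      -- rounded-down halves of d.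
      K = ⌊ d′ /2⌋
      δ = ⌈ d′ /2⌉
      d = δ ℕ.+ suc K
      m₁ = m ℕ.∸ K
      m₂ = m ℕ.∸ δ
      g₁ = 2 ℕ.* n ℕ.+ d ℕ.∸ 4 ℕ.* K
      g₂ = 2 ℕ.* n ℕ.∸ d

      d≡ : d ≡ suc d′
      d≡ = ℕ.⌊n/2⌋+⌈n/2⌉≡n (suc d′)

      d≤m′ : d ℕ.≤ m
      d≤m′ = subst (ℕ._≤ m) (sym d≡) d≤m

    open Transport X Y (trans XY (sym d≡)) d≤m′ 1≤q public using (value; lower; upper)

    private
      open Transport X Y (trans XY (sym d≡)) d≤m′ 1≤q using (dual; N)

      K≤δ : K ℕ.≤ δ
      K≤δ = ℕ.⌊n/2⌋≤⌈n/2⌉ d′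

      δ≤ : δ ℕ.≤ suc K
      δ≤ with ⌈n/2⌉≡⌊n/2⌋⊎1+ d′
      ... | inj₁ e = ℕ.≤-trans (ℕ.≤-reflexive e) (ℕ.n≤1+n K)
      ... | inj₂ e = ℕ.≤-reflexive e

      δ≤m : δ ℕ.≤ m
      δ≤m = ℕ.≤-trans (ℕ.m≤m+n δ (suc K)) d≤m′

      K≤m : K ℕ.≤ m
      K≤m = ℕ.≤-trans K≤δ δ≤m

      m₁+ : K ℕ.+ m₁ ≡ m
      m₁+ = ℕ.m+[n∸m]≡n K≤m

      m₂+ : δ ℕ.+ m₂ ≡ m
      m₂+ = ℕ.m+[n∸m]≡n δ≤m

      e₁ : g₁ ℕ.+ 4 ℕ.* K ≡ 2 ℕ.* n ℕ.+ d
      e₁ = ℕ.m∸n+n≡m {2 ℕ.* n ℕ.+ d} {4 ℕ.* K} (linear 3 (ℕ.+-mono-≤ K≤m (ℕ.+-mono-≤ K≤m K≤δ)) (lemma K m δ))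
        where
        lemma : ∀ K m δ → 4 ℕ.* K ℕ.+ (m ℕ.+ (m ℕ.+ δ)) ℕ.+ 3 ≡ 2 ℕ.* suc m ℕ.+ (δ ℕ.+ suc K) ℕ.+ (K ℕ.+ (K ℕ.+ K))
        lemma = solve-∀

      e₂ : g₂ ℕ.+ d ≡ 2 ℕ.* n
      e₂ = ℕ.m∸n+n≡m {2 ℕ.* n} {d} (ℕ.≤-trans d≤m′ (ℕ.≤-trans (ℕ.n≤1+n m) (ℕ.m≤m+n n (n ℕ.+ 0))))

      power>0 : ∀ k → 0 ℕ.< q ^ k
      power>0 k = ℕ.m^n>0 q ⦃ ℕ.>-nonZero 1≤q ⦄ k

      N>0 : 0 ℕ.< N
      N>0 = ℕ.*-mono-≤ (s≤s (z≤n {q})) (power>0 m)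

      Q : ℚ
      Q = ℕ→ℚ q

      cast-suc : ∀ k → ℕ→ℚ (suc k) ≡ 1ℚ + ℕ→ℚ k
      cast-suc k = ℕ→ℚ-+ 1 k

      cast-N : ℕ→ℚ N ≡ (1ℚ + Q) * ℕ→ℚ (q ^ m)
      cast-N = trans (ℕ→ℚ-* (suc q) (q ^ m)) (cong (_* ℕ→ℚ (q ^ m)) (cast-suc q))

      cast-d : ℕ→ℚ d ≡ ℕ→ℚ δ + (1ℚ + ℕ→ℚ K)
      cast-d = trans (ℕ→ℚ-+ δ (suc K)) (cong (ℕ→ℚ δ +_) (cast-suc K))

      cast-pred : ∀ k → 1 ℕ.≤ k → ℕ→ℚ (k ℕ.∸ 1) ≡ ℕ→ℚ k - 1ℚ
      cast-pred (suc k) _ = trans (solve 1 (λ k → k := con 1ℚ :+ k :- con 1ℚ) refl (ℕ→ℚ k)) (cong (_- 1ℚ) (sym (cast-suc k)))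
        where open +-*-Solver

      1≤q*q : 1 ℕ.≤ q ℕ.* q
      1≤q*q = ℕ.*-mono-≤ 1≤q 1≤q

      0<q²-1 : 0 ℕ.< q ℕ.* q ℕ.∸ 1
      0<q²-1 = ℕ.m<n⇒0<n∸m (ℕ.*-mono-≤ 2≤q 1≤q)

      cast-q²-1 : ℕ→ℚ (q ℕ.* q ℕ.∸ 1) ≡ Q * Q - 1ℚ
      cast-q²-1 = trans (cast-pred (q ℕ.* q) 1≤q*q) (cong (_- 1ℚ) (ℕ→ℚ-* q q))

      hM₁ : ℕ→ℚ (q ^ m₁) * ℕ→ℚ (q ^ suc K) ≡ Q * ℕ→ℚ (q ^ m)
      hM₁ = trans (sym (ℕ→ℚ-* (q ^ m₁) (q ^ suc K))) (trans (cong ℕ→ℚ eq) (ℕ→ℚ-* q (q ^ m)))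
        where
        eq : q ^ m₁ ℕ.* q ^ suc K ≡ q ^ suc m
        eq = trans (sym (ℕ.^-distribˡ-+-* q m₁ (suc K))) (cong (q ^_) (trans (ℕ.+-comm m₁ (suc K)) (cong suc m₁+)))

      hM₂ : ℕ→ℚ (q ^ m₂) * ℕ→ℚ (q ^ δ) ≡ ℕ→ℚ (q ^ m)
      hM₂ = trans (sym (ℕ→ℚ-* (q ^ m₂) (q ^ δ)))
        (cong ℕ→ℚ (trans (sym (ℕ.^-distribˡ-+-* q m₂ δ)) (cong (q ^_) (trans (ℕ.+-comm m₂ δ) m₂+))))

      ht : (Q + 1ℚ) * inv (q ℕ.+ 1) ≡ 1ℚ
      ht = trans (cong (_* inv (q ℕ.+ 1)) (sym (ℕ→ℚ-+ q 1))) (ℕ→ℚ*inv (q ℕ.+ 1) (ℕ.≤-trans (s≤s z≤n) (ℕ.m≤n+m 1 q)))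

      hgeo : Q * ℕ→ℚ (geometric q n K) + Q * ℕ→ℚ (q ^ m₁) ≡ ℕ→ℚ (geometric q n K) + Q * ℕ→ℚ (q ^ m)
      hgeo = begin
        Q * ℕ→ℚ G + Q * ℕ→ℚ (q ^ m₁)             ≡⟨ cong₂ _+_ (ℕ→ℚ-* q G) (ℕ→ℚ-* q (q ^ m₁)) ⟨
        ℕ→ℚ (q ℕ.* G) + ℕ→ℚ (q ^ suc m₁)         ≡⟨ ℕ→ℚ-+ (q ℕ.* G) (q ^ suc m₁) ⟨
        ℕ→ℚ (q ℕ.* G ℕ.+ q ^ suc m₁)             ≡⟨ cong (λ k → ℕ→ℚ (q ℕ.* G ℕ.+ q ^ k)) (sym (ℕ.+-∸-assoc 1 K≤m)) ⟩
        ℕ→ℚ (q ℕ.* G ℕ.+ q ^ (n ℕ.∸ K))          ≡⟨ cong ℕ→ℚ (geometric-sum q n K (ℕ.≤-trans K≤m (ℕ.n≤1+n m))) ⟩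
        ℕ→ℚ (G ℕ.+ q ^ n)                        ≡⟨ ℕ→ℚ-+ G (q ^ n) ⟩
        ℕ→ℚ G + ℕ→ℚ (q ^ n)                      ≡⟨ cong (ℕ→ℚ G +_) (ℕ→ℚ-* q (q ^ m)) ⟩
        ℕ→ℚ G + Q * ℕ→ℚ (q ^ m)                  ∎
        where
        open ≡-Reasoning
        G : ℕ
        G = geometric q n K

      hg₁ : ℕ→ℚ g₁ + 4ℚ * ℕ→ℚ K ≡ 2ℚ * ℕ→ℚ n + (ℕ→ℚ δ + (1ℚ + ℕ→ℚ K))
      hg₁ = begin
        ℕ→ℚ g₁ + 4ℚ * ℕ→ℚ K               ≡⟨ cong (ℕ→ℚ g₁ +_) (ℕ→ℚ-* 4 K) ⟨
        ℕ→ℚ g₁ + ℕ→ℚ (4 ℕ.* K)            ≡⟨ ℕ→ℚ-+ g₁ (4 ℕ.* K) ⟨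
        ℕ→ℚ (g₁ ℕ.+ 4 ℕ.* K)              ≡⟨ cong ℕ→ℚ e₁ ⟩
        ℕ→ℚ (2 ℕ.* n ℕ.+ d)               ≡⟨ ℕ→ℚ-+ (2 ℕ.* n) d ⟩
        ℕ→ℚ (2 ℕ.* n) + ℕ→ℚ d             ≡⟨ cong₂ _+_ (ℕ→ℚ-* 2 n) cast-d ⟩
        2ℚ * ℕ→ℚ n + (ℕ→ℚ δ + (1ℚ + ℕ→ℚ K)) ∎
        where open ≡-Reasoning

      hg₂ : ℕ→ℚ g₂ + (ℕ→ℚ δ + (1ℚ + ℕ→ℚ K)) ≡ 2ℚ * ℕ→ℚ n
      hg₂ = trans (cong (ℕ→ℚ g₂ +_) (sym cast-d)) (trans (sym (ℕ→ℚ-+ g₂ d)) (trans (cong ℕ→ℚ e₂) (ℕ→ℚ-* 2 n)))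

      parity : (ℕ→ℚ δ ≡ ℕ→ℚ K × inv (q ^ δ) ≡ Q * inv (q ^ suc K)) ⊎ (ℕ→ℚ δ ≡ 1ℚ + ℕ→ℚ K × inv (q ^ δ) ≡ inv (q ^ suc K))
      parity with ⌈n/2⌉≡⌊n/2⌋⊎1+ d′
      ... | inj₁ e = inj₁ (cong ℕ→ℚ e , trans (cong (λ k → inv (q ^ k)) e) (sym (inv-unique (power>0 K) eq)))
        where
        open +-*-Solver
        eq : ℕ→ℚ (q ^ K) * (Q * inv (q ^ suc K)) ≡ 1ℚ
        eq = trans (solve 3 (λ w q i → w :* (q :* i) := q :* w :* i) refl (ℕ→ℚ (q ^ K)) Q (inv (q ^ suc K)))
          (trans (cong (_* inv (q ^ suc K)) (sym (ℕ→ℚ-* q (q ^ K)))) (ℕ→ℚ*inv (q ^ suc K) (power>0 (suc K))))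
      ... | inj₂ e = inj₂ (trans (cong ℕ→ℚ e) (cast-suc K) , cong (λ k → inv (q ^ k)) e)

      total : Vertex q → Vertex q → ℚ
      total x y = Σ[ sphere x n ] (λ v → ℕ→ℚ (potential n d (dist y v)))

      -- The constant in `dual` integrates to itself, because the sphere has total mass 1.
      half : ∀ x y → Σ[ sphere x n ] (λ v → dual (dist y v) * inv (length (sphere x n))) ≡ ½ * (total x y * inv N - ℕ→ℚ (d ℕ.+ 2 ℕ.* n))
      half x y = begin
        Σ[ S ] (λ v → dual (dist y v) * inv (length S))     ≡⟨ Σ-*ʳ S (inv (length S)) (λ v → dual (dist y v)) ⟩
        Σ[ S ] (λ v → ½ * (f v + - c₀)) * inv (length S)    ≡⟨ cong (_* inv (length S)) (Σ-* S ½ (λ v → f v + - c₀)) ⟩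
        ½ * Σ[ S ] (λ v → f v + - c₀) * inv (length S)      ≡⟨ cong (λ z → ½ * z * inv (length S)) (trans (Σ-+ S f (λ _ → - c₀)) (cong (Σ[ S ] f +_) (Σ-const S (- c₀)))) ⟩
        ½ * (Σ[ S ] f + ℕ→ℚ (length S) * - c₀) * inv (length S)   ≡⟨ cong (λ l → ½ * (Σ[ S ] f + ℕ→ℚ l * - c₀) * inv l) (sphere-length x m) ⟩
        ½ * (Σ[ S ] f + ℕ→ℚ N * - c₀) * inv N               ≡⟨ solve 4 (λ s l c i → con ½ :* (s :+ l :* (:- c)) :* i := con ½ :* (s :* i :- (l :* i) :* c)) refl (Σ[ S ] f) (ℕ→ℚ N) c₀ (inv N) ⟩
        ½ * (Σ[ S ] f * inv N - (ℕ→ℚ N * inv N) * c₀)       ≡⟨ cong (λ z → ½ * (Σ[ S ] f * inv N - z)) (trans (cong (_* c₀) (ℕ→ℚ*inv N N>0)) (*-identityˡ c₀)) ⟩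
        ½ * (Σ[ S ] f * inv N - c₀)                         ∎
        where
        open ≡-Reasoning
        open +-*-Solver
        S = sphere x n
        c₀ : ℚ
        c₀ = ℕ→ℚ (d ℕ.+ 2 ℕ.* n)
        f : Vertex q → ℚ
        f v = ℕ→ℚ (potential n d (dist y v))

      target : ℚ
      target = Asphere (suc d′) q * ℕ→ℚ n + Bsphere (suc d′) q

      evaluated : ∀ x y → dist x y ≡ d → total x y * inv N - ℕ→ℚ (d ℕ.+ 2 ℕ.* n) ≡ target
      evaluated x y xy = begin
        total x y * inv N - ℕ→ℚ (d ℕ.+ 2 ℕ.* n)
          ≡⟨ cong (λ z → total x y * inv N - z) (trans (ℕ→ℚ-+ d (2 ℕ.* n)) (cong₂ _+_ cast-d (ℕ→ℚ-* 2 n))) ⟩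
        total x y * inv N - (ℕ→ℚ δ + (1ℚ + ℕ→ℚ K) + 2ℚ * ℕ→ℚ n)
          ≡⟨ Evaluation.odd-or-even {Q} {ℕ→ℚ n} {ℕ→ℚ δ} {ℕ→ℚ K} {ℕ→ℚ (q ^ m)} {ℕ→ℚ (q ^ m₁)} {ℕ→ℚ (q ^ m₂)} {ℕ→ℚ (q ^ suc K)} {ℕ→ℚ (q ^ δ)}
               {inv (q ^ suc K)} {inv (q ^ δ)} {inv (q ℕ.+ 1)} {inv (q ℕ.* q ℕ.∸ 1)} {inv N}
               (trans (cong (_* inv N) (sym cast-N)) (ℕ→ℚ*inv N N>0)) (ℕ→ℚ*inv (q ^ suc K) (power>0 (suc K))) (ℕ→ℚ*inv (q ^ δ) (power>0 δ)) ht
               (trans (cong (_* inv (q ℕ.* q ℕ.∸ 1)) (sym cast-q²-1)) (ℕ→ℚ*inv (q ℕ.* q ℕ.∸ 1) 0<q²-1)) hM₁ hM₂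
               {total x y} {ℕ→ℚ (geometric q n K)} {ℕ→ℚ g₁} {ℕ→ℚ g₂} hS hgeo hg₁ hg₂ parity ⟩
        (2ℚ * ((Q + 1ℚ) - Q * inv (q ^ suc K) - inv (q ^ δ))) * inv (q ℕ.+ 1) * ℕ→ℚ n
          + (ℕ→ℚ δ + (1ℚ + ℕ→ℚ K) + (- (4ℚ * Q) + 2ℚ * ((1ℚ + ℕ→ℚ K) * (Q - 1ℚ) + 1ℚ) * Q * inv (q ^ suc K) + 2ℚ * (ℕ→ℚ δ * (Q - 1ℚ) + Q) * inv (q ^ δ)) * inv (q ℕ.* q ℕ.∸ 1))
          ≡⟨ cong₂ _+_ (cong (λ z → (2ℚ * (z - Q * inv (q ^ suc K) - inv (q ^ δ))) * inv (q ℕ.+ 1) * ℕ→ℚ n) (sym (ℕ→ℚ-+ q 1)))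
               (cong₂ (λ y z → y + z * inv (q ℕ.* q ℕ.∸ 1)) (trans (sym cast-d) (cong ℕ→ℚ d≡))
                 (cong₂ _+_ (cong₂ (λ y z → - y + 2ℚ * z * Q * inv (q ^ suc K)) (sym (ℕ→ℚ-* 4 q)) (sym (linear-cast (suc K) 1 (cast-suc K) refl)))
                   (cong (λ z → 2ℚ * z * inv (q ^ δ)) (sym (linear-cast δ q refl refl))))) ⟩
        target ∎
        where
        open ≡-Reasoning
        linear-cast : ∀ a b {a′ b′} → ℕ→ℚ a ≡ a′ → ℕ→ℚ b ≡ b′ → ℕ→ℚ (a ℕ.* (q ℕ.∸ 1) ℕ.+ b) ≡ a′ * (Q - 1ℚ) + b′
        linear-cast a b refl refl = trans (ℕ→ℚ-+ (a ℕ.* (q ℕ.∸ 1)) b)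
          (cong (_+ ℕ→ℚ b) (trans (ℕ→ℚ-* a (q ℕ.∸ 1)) (cong (ℕ→ℚ a *_) (cast-pred q 1≤q))))
        hS : total x y + 4ℚ * ℕ→ℚ (geometric q n K) + ℕ→ℚ g₁ * ℕ→ℚ (q ^ m₁) + ℕ→ℚ g₂ * ℕ→ℚ (q ^ m₂)
          ≡ (1ℚ + Q) * ℕ→ℚ (q ^ m) * (4ℚ * ℕ→ℚ n + 2ℚ * (ℕ→ℚ δ + (1ℚ + ℕ→ℚ K)))
        hS = trans (Σ-potential x y K≤δ δ≤ xy (s≤s d≤m′) {g₁} {g₂} {m₁} {m₂} e₁ e₂ (cong suc m₁+) (cong suc m₂+))
          (cong₂ _*_ (trans (cong ℕ→ℚ (sphere-length x m)) cast-N)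
            (trans (ℕ→ℚ-+ (4 ℕ.* n) (2 ℕ.* d)) (cong₂ _+_ (ℕ→ℚ-* 4 n) (trans (ℕ→ℚ-* 2 d) (cong (2ℚ *_) cast-d)))))

    -- The two spheres contribute equally by symmetry, and twice either contribution is `target`.
    value≡ : value ≡ target
    value≡ = trans (cong₂ _+_ (trans (half X Y) (cong (½ *_) (evaluated X Y XY′))) (trans (half Y X) (cong (½ *_) (evaluated Y X (trans (dist-sym Y X) XY′)))))
      (solve 1 (λ z → con ½ :* z :+ con ½ :* z := z) refl target)
      where
      open +-*-Solver
      XY′ : dist X Y ≡ d
      XY′ = trans XY (sym d≡)

  sphere-bounds : ∀ {q} d → 2 ℕ.≤ q → (X Y : Vertex q) → dist X Y ≡ suc d → ∀ {ε} → 0ℚ < ε → ∀ n → suc (suc d) ℕ.≤ n →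
    W₁≤ (σ X n) (σ Y n) (Asphere (suc d) q * ℕ→ℚ n + Bsphere (suc d) q + ε)
    × ≤W₁ (Asphere (suc d) q * ℕ→ℚ n + Bsphere (suc d) q - ε) (σ X n) (σ Y n)
  sphere-bounds {q} d 2≤q X Y XY {ε} 0<ε (suc m) (s≤s d≤m) =
    (let π , coupling , cost≤ = upper in π , coupling , ≤-trans cost≤ (≤-trans (≤-reflexive value≡) target≤))
    , λ π coupling → ≤-trans target≥ (≤-trans (≤-reflexive (sym value≡)) (lower π coupling))
    where
    open Value 2≤q X Y XY d≤m
    z : ℚ
    z = Asphere (suc d) q * ℕ→ℚ (suc m) + Bsphere (suc d) q
    target≤ : z ≤ z + ε
    target≤ = subst (_≤ z + ε) (+-identityʳ z) (+-monoʳ-≤ z (<⇒≤ 0<ε))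
    target≥ : z - ε ≤ z
    target≥ = subst (z - ε ≤_) (+-identityʳ z) (+-monoʳ-≤ z (neg-antimono-≤ (<⇒≤ 0<ε)))

open import Data.Nat using (ℕ; suc; _≤_)
open import Data.Rational using (ℚ; 0ℚ; _<_; _+_; _-_; _*_)

theorem7p12 : (q d : ℕ) → 2 ≤ q → 1 ≤ d → (X Y : Vertex q) → dist X Y ≡ d →
    (ε : ℚ) → 0ℚ < ε → ∃ λ (N : ℕ) → (n : ℕ) → N ≤ n →
    W₁≤ (σ X n) (σ Y n) (Asphere d q * ℕ→ℚ n + Bsphere d q + ε)
    × ≤W₁ (Asphere d q * ℕ→ℚ n + Bsphere d q - ε) (σ X n) (σ Y n)
-- Here the distance is `suc d`, so the threshold `suc (suc d)` says that the radius exceeds the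
-- distance.
theorem7p12 q (suc d) 2≤q _ X Y XY ε 0<ε = suc (suc d) , Transportation.sphere-bounds d 2≤q X Y XY 0<ε
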